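{- Let $m\geq 1$ and $0\leq l\leq m$, let $1\leq i_1\leq\cdots\leq i_l$ and $1\leq i_{l+1}\leq\cdots\leq i_m$ be integers, and let $q\geq 1$ be an integer. For a composition $\theta=(\theta_1,\theta_2,\ldots,\theta_p)\in\mathcal{C}_m$ (where $p$ is the number of parts of $\theta$), a permutation $\rho\in\mathcal{S}_m$ and $c=1,2,\ldots,p$, put $$\lambda_c=\sum_{k=1}^{\theta_c}\chi_{\mathbb{N}}\big(\rho(\theta_1+\cdots+\theta_{c-1}+k)-l\big),$$ $$\tilde{T}_c(\theta,\rho)=\begin{cases}\overline{i_{\rho(\theta_1+\cdots+\theta_{c-1}+1)}+\cdots+i_{\rho(\theta_1+\cdots+\theta_c)}}, & \text{if }\lambda_c\text{ is odd},\\ i_{\rho(\theta_1+\cdots+\theta_{c-1}+1)}+\cdots+i_{\rho(\theta_1+\cdots+\theta_c)}, & \text{if }\lambda_c\text{ is even},\end{cases}$$ $$\check{T}_1(\theta,\rho)=\begin{cases}\overline{q+i_{\rho(1)}+\cdots+i_{\rho(\theta_1)}}, & \text{if }\lambda_1\text{ is even},\\ q+i_{\rho(1)}+\cdots+i_{\rho(\theta_1)}, & \text{if }\lambda_1\text{ is odd}.\end{cases}$$ Then $$S_{i_1\cdots i_l\bar{i}_{l+1}\cdots\bar{i}_m,\bar{q}}=\sum_{\theta\in\mathcal{C}_m}\sum_{\rho\in\mathcal{S}_m}\frac{(-1)^{\lambda_1+\cdots+\lambda_p+1}}{\theta_1!\cdots\theta_p!}\Big\{\zeta\big(\bar{q}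,\tilde{T}_1(\theta,\rho),\ldots,\tilde{T}_p(\theta,\rho)\big)+\zeta\big(\check{T}_1(\theta,\rho),\tilde{T}_2(\theta,\rho),\ldots,\tilde{T}_p(\theta,\rho)\big)\Big\}.$$
   Context: Harmonic numbers and alternating harmonic numbers: $H_n^{(r)}=\sum_{k=1}^n\frac{1}{k^r}$ and $\bar{H}_n^{(r)}=\sum_{k=1}^n\frac{(-1)^{k-1}}{k^r}$ for positive integers $n,r$. Alternating Euler sums (second kind): $$S_{i_1\cdots i_l\bar{i}_{l+1}\cdots\bar{i}_m,\bar{q}}=\sum_{n=1}^{\infty}(-1)^{n-1}\frac{H_n^{(i_1)}\cdots H_n^{(i_l)}\bar{H}_n^{(i_{l+1})}\cdots\bar{H}_n^{(i_m)}}{n^q},$$ the infinite sum being the limit of its partial sums. Alternating multiple zeta values: for positive integers $s_j$ and signs $\sigma_j=\pm1$ with $(s_1,\sigma_1)\neq(1,1)$, $$\zeta(s_1,\ldots,s_k;\sigma_1,\ldots,\sigma_k)=\lim_{n\to\infty}\sum_{n\geq n_1>n_2>\cdots>n_k\geq 1}\frac{\sigma_1^{n_1}\cdots\sigma_k^{n_k}}{n_1^{s_1}\cdots n_k^{s_k}}.$$ The exponents and signs are combined into a single string, with $s_j$ in the $j$th position when $\sigma_j=+1$ and $\bar{s}_j$ (or $\overline{s_j}$) in the $j$th position when $\sigma_j=-1$; e.g. $\zeta(\bar{s}_1,s_2)=\zeta(s_1,s_2;-1,1)$. $\chi_{\mathbb{N}}$ is the characteristic function of the set of positive integers: $\chi_{\mathbb{N}}(x)=1$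 if $x$ is a positive integer and $0$ otherwise. $\mathcal{S}_m$ is the symmetric group on $\{1,\ldots,m\}$; a composition of $m$ is an ordered tuple of positive integers summing to $m$, and $\mathcal{C}_m$ is the set of all compositions of $m$. For $c=1$, the empty sum $\theta_1+\cdots+\theta_{c-1}$ is $0$. -}

module Defs where

open import Data.Nat.Base as ℕ using (ℕ; zero; suc; _!)
import Data.Nat.Properties as ℕ
open import Data.Integer.Base as ℤ using (ℤ; -1ℤ; _◃_)
import Data.Integer.Properties as ℤ
open import Data.Rational.Base
open import Data.Rational.Properties
import Data.Rational.Unnormalised.Base as ℚᵘ
import Data.Rational.Unnormalised.Properties as ℚᵘ
open import Data.Rational.Solver using (module +-*-Solver)
import Data.Nat.Solver
open import Data.Sign.Base as Sign using (Sign)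
open import Data.Parity.Base using (toSign)
open import Data.Fin.Base as Fin using (Fin; toℕ; _↑ˡ_; _↑ʳ_)
open import Data.Fin.Permutation as Perm using (Permutation′; _⟨$⟩ʳ_; insert; remove)
open import Data.List.Base as List using (List; []; _∷_; _++_; allFin; cartesianProductWith)
open import Data.Nat.ListAction using (sum)
open import Data.List.Properties using (length-map; length-++; length-tabulate)
open import Data.List.NonEmpty.Base as List⁺ using (List⁺; _∷_)
open import Data.List.Membership.Propositional using (_∈_)
open import Data.List.Membership.Propositional.Properties
  using (∈-map⁺; ∈-map⁻; ∈-++⁺ˡ; ∈-++⁺ʳ; ∈-cartesianProductWith⁺; ∈-allFin)
open import Data.List.Relation.Unary.Any using (here)
open import Data.List.Relation.Unary.All as All using ([])
open import Data.List.Relation.Unary.AllPairs using ([]; _∷_)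
open import Data.List.Relation.Unary.Unique.Propositional using (Unique)
import Data.List.Relation.Unary.Unique.Propositional.Properties as Unique
import Data.Vec.Base as Vec
open import Data.Vec.Functional as Vector using (Vector)
open import Data.Bool.Base using (true; false; if_then_else_)
open import Data.Product.Base using (∃-syntax; _×_; _,_)
open import Data.Sum.Base using (inj₁; inj₂)
open import Function.Base using (_∘_)
open import Relation.Binary.PropositionalEquality
open import Relation.Nullary using (¬_; contradiction)
open +-*-Solver using (solve; _:=_; _:+_; _:*_; _:-_; :-_; con)

Null : (ℕ → ℚ) → Set
Null a = ∀ ε → 0ℚ < ε → ∃[ N ] ∀ n → N ℕ.≤ n → ∣ a n ∣ < ε

IsCauchy : (ℕ → ℚ) → Set
IsCauchy a = ∀ ε → 0ℚ < ε → ∃[ N ] ∀ m n → N ℕ.≤ m → N ℕ.≤ n → ∣ a m - a n ∣ < ε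

-- A real number is given by a Cauchy sequence of rationals, and stands for its
-- limit; two sequences have the same limit when their difference tends to 0.
-- In particular, lim a c is the limit of the convergent rational sequence a.
record ℝ : Set where
  constructor lim
  field
    seq    : ℕ → ℚ
    cauchy : IsCauchy seq

open ℝ

infix 4 _≈_

_≈_ : ℝ → ℝ → Set
x ≈ y = Null (λ n → seq x n - seq y n)

record ℕ⁺ : Set where
  constructor mk⁺
  field
    value       : ℕ
    {{value≢0}} : ℕ.NonZero value

open ℕ⁺ public using (value)

infixl 6 _+⁺_

_+⁺_ : ℕ⁺ → ℕ⁺ → ℕ⁺
mk⁺ (suc a) +⁺ mk⁺ b = mk⁺ (suc a ℕ.+ b)

∑< : ℕ → (ℕ → ℚ) → ℚ
∑< zero    f = 0ℚ
∑< (suc n) f = ∑< n f + f n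

-- A sum over 1 ≤ n ≤ N is written below as ∑< N λ k → …, with n = suc k.

infixl 7 _/[1+_]^_

_/[1+_]^_ : ℤ → ℕ → ℕ⁺ → ℚ
z /[1+ k ]^ s = (z / (suc k ℕ.^ value s)) {{ℕ.m^n≢0 (suc k) (value s)}}

H : ℕ⁺ → ℕ → ℚ
H r n = ∑< n λ k → ℤ.+ 1 /[1+ k ]^ r

H̄ : ℕ⁺ → ℕ → ℚ
H̄ r n = ∑< n λ k → (-1ℤ ℤ.^ k) /[1+ k ]^ r

∏ : ∀ {m} → Vector ℚ m → ℚ
∏ = Vector.foldr _*_ 1ℚ

-- Fin m is 0-based: the index in {1,…,m} denoted by j : Fin m is suc (toℕ j), so
-- the first l indices are those with toℕ j < l.
harmonicFactor : ∀ {m} → ℕ → Vector ℕ⁺ m → ℕ → Vector ℚ m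
harmonicFactor l i n j = if toℕ j ℕ.<ᵇ l then H (i j) n else H̄ (i j) n

S-partial : ∀ {m} → ℕ → Vector ℕ⁺ m → ℕ⁺ → ℕ → ℚ
S-partial l i q N =
  ∑< N λ k → (-1ℤ ℤ.^ k) /[1+ k ]^ q * ∏ (harmonicFactor l i (suc k))

-- An entry (s , σ) is s if σ = + and s̄ if σ = -.
Entry : Set
Entry = ℕ⁺ × Sign

-- The sum over n ≥ n₁ > ⋯ > n_k ≥ 1, taken one variable at a time: the
-- remaining variables run over n₁ - 1 ≥ n₂ > ⋯ > n_k ≥ 1.
ζ-partial : List Entry → ℕ → ℚ
ζ-partial []            n = 1ℚ
ζ-partial ((s , σ) ∷ w) n = ∑< n λ k → ((σ ◃ 1) ℤ.^ suc k) /[1+ k ]^ s * ζ-partial w k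

Admissible : List⁺ Entry → Set
Admissible ((s , σ) ∷ w) = ¬ (value s ≡ 1 × σ ≡ Sign.+)

-- Convergence of the two series. With L n = 1 + H_n, the sequences multiplying
-- ±1/nˢ in them are bounded by C·Lᵏ and have increments bounded by C·Lᵏ/n
-- (Tame). Each power of L is dominated by P n = ∏_{j≤n} (1 + 1/(3j)), whose
-- square is at most n + 1, so that ∑ P n / n² converges.
module Convergence where

  ≤0+ : ∀ {p q} → 0ℚ ≤ p → 0ℚ ≤ q → 0ℚ ≤ p + q
  ≤0+ = +-mono-≤

  *-mono : ∀ {p q r s} → 0ℚ ≤ p → p ≤ q → 0ℚ ≤ r → r ≤ s → p * r ≤ q * s
  *-mono {p} {q} {r} {s} 0≤p p≤q 0≤r r≤s =
    ≤-trans (*-monoʳ-≤-nonNeg r {{nonNegative 0≤r}} p≤q)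
            (*-monoˡ-≤-nonNeg q {{nonNegative (≤-trans 0≤p p≤q)}} r≤s)

  *-monoˡ : ∀ {p q} r → 0ℚ ≤ r → p ≤ q → r * p ≤ r * q
  *-monoˡ r 0≤r = *-monoˡ-≤-nonNeg r {{nonNegative 0≤r}}

  0≤* : ∀ {p q} → 0ℚ ≤ p → 0ℚ ≤ q → 0ℚ ≤ p * q
  0≤* 0≤p 0≤q = *-mono ≤-refl 0≤p ≤-refl 0≤q

  0<* : ∀ {p q} → 0ℚ < p → 0ℚ < q → 0ℚ < p * q
  0<* {p} {q} 0<p 0<q =
    positive⁻¹ (p * q) {{pos*pos⇒pos p {{positive 0<p}} q {{positive 0<q}}}}

  0≤1 : 0ℚ ≤ 1ℚ
  0≤1 = nonNegative⁻¹ 1ℚ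

  ∣*∣-mono : ∀ {p q r s} → ∣ p ∣ ≤ q → ∣ r ∣ ≤ s → ∣ p * r ∣ ≤ q * s
  ∣*∣-mono {p} {q} {r} {s} p≤ r≤ =
    subst (_≤ q * s) (sym (∣p*q∣≡∣p∣*∣q∣ p r)) (*-mono (0≤∣p∣ p) p≤ (0≤∣p∣ r) r≤)

  ∣+∣-mono : ∀ {p q r s} → ∣ p ∣ ≤ q → ∣ r ∣ ≤ s → ∣ p + r ∣ ≤ q + s
  ∣+∣-mono {p} {r = r} p≤ r≤ = ≤-trans (∣p+q∣≤∣p∣+∣q∣ p r) (+-mono-≤ p≤ r≤)

  ∣p-q∣≡∣q-p∣ : ∀ p q → ∣ p - q ∣ ≡ ∣ q - p ∣
  ∣p-q∣≡∣q-p∣ p q = trans (cong ∣_∣ (solve 2 (λ p q → p :- q := :- (q :- p)) refl p q)) (∣-p∣≡∣p∣ (q - p))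

  0≤p-q : ∀ {p q} → q ≤ p → 0ℚ ≤ p - q
  0≤p-q {p} {q} q≤p = subst (_≤ p - q) (+-inverseʳ q) (+-monoˡ-≤ (- q) q≤p)

  p-q≤p : ∀ p {q} → 0ℚ ≤ q → p - q ≤ p
  p-q≤p p {q} 0≤q = subst (p - q ≤_) (+-identityʳ p) (+-monoʳ-≤ p (neg-antimono-≤ 0≤q))

  ∣p-q∣≤ : ∀ {p q c} → 0ℚ ≤ p → p ≤ c → 0ℚ ≤ q → q ≤ c → ∣ p - q ∣ ≤ c
  ∣p-q∣≤ {p} {q} 0≤p p≤c 0≤q q≤c with ∣p∣≡p∨∣p∣≡-p (p - q)
  ... | inj₁ eq = subst (_≤ _) (sym eq) (≤-trans (p-q≤p p 0≤q) p≤c)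
  ... | inj₂ eq = subst (_≤ _) (sym (trans eq (solve 2 (λ p q → :- (p :- q) := q :- p) refl p q)))
                    (≤-trans (p-q≤p q 0≤p) q≤c)

  small-mult-eq : ∀ K ε r → K * (ε * r) + ε * r ≡ ε * ((K + 1ℚ) * r)
  small-mult-eq K ε r =
    trans (solve 3 (λ K ε r → K :* (ε :* r) :+ ε :* r := ε :* (K :* r :+ r)) refl K ε r)
          (cong (ε *_) (trans (cong ((K * r) +_) (sym (*-identityˡ r))) (sym (*-distribʳ-+ r K 1ℚ))))

  small-mult : ∀ K ε → 0ℚ ≤ K → 0ℚ < ε → ∃[ δ ] 0ℚ < δ × K * δ < ε
  small-mult K ε 0≤K 0<ε = δ , 0<δ , subst (K * δ <_) eq (subst₂ _<_ (+-identityʳ _) refl (+-monoʳ-< (K * δ) 0<δ))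
    where
    0<K+1 : 0ℚ < K + 1ℚ
    0<K+1 = +-mono-≤-< 0≤K (positive⁻¹ 1ℚ)
    instance
      K+1>0 : Positive (K + 1ℚ)
      K+1>0 = positive 0<K+1
      nz : NonZero (K + 1ℚ)
      nz = pos⇒nonZero (K + 1ℚ)
    r = 1/ (K + 1ℚ)
    δ = ε * r
    0<δ : 0ℚ < δ
    0<δ = 0<* 0<ε (positive⁻¹ r {{1/pos⇒pos (K + 1ℚ)}})
    eq : K * δ + δ ≡ ε
    eq = begin
      K * (ε * r) + ε * r  ≡⟨ small-mult-eq K ε r ⟩
      ε * ((K + 1ℚ) * r)   ≡⟨ cong (ε *_) (*-inverseʳ (K + 1ℚ)) ⟩
      ε * 1ℚ               ≡⟨ *-identityʳ ε ⟩
      ε ∎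
      where open ≡-Reasoning

  Null-dom : ∀ {a b} K → 0ℚ ≤ K → Null a → (∀ n → ∣ b n ∣ ≤ K * ∣ a n ∣) → Null b
  Null-dom K 0≤K na b≤ ε 0<ε =
    let δ , 0<δ , Kδ<ε = small-mult K ε 0≤K 0<ε
        N , h = na δ 0<δ
    in N , λ n N≤n → ≤-<-trans (≤-trans (b≤ n) (*-monoˡ K 0≤K (<⇒≤ (h n N≤n)))) Kδ<ε

  2ℚ : ℚ
  2ℚ = 1ℚ + 1ℚ

  Cauchy-dom : ∀ {a t} K → 0ℚ ≤ K → Null t → (∀ N d → ∣ a (d ℕ.+ N) - a N ∣ ≤ K * ∣ t N ∣) → IsCauchy a
  Cauchy-dom {a} {t} K 0≤K nt a≤ ε 0<ε =
    let δ , 0<δ , Kδ<ε = small-mult (K + K) ε (≤0+ 0≤K 0≤K) 0<ε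
        N , h = nt δ 0<δ
    in N , λ m n N≤m N≤n → ≤-<-trans (bound δ N h m n N≤m N≤n) Kδ<ε
    where
    open ≤-Reasoning
    step : ∀ δ N → (∀ n → N ℕ.≤ n → ∣ t n ∣ < δ) → ∀ n → N ℕ.≤ n → ∣ a n - a N ∣ ≤ K * δ
    step δ N h n N≤n = begin
      ∣ a n - a N ∣                     ≡⟨ cong (λ k → ∣ a k - a N ∣) (sym (ℕ.m∸n+n≡m N≤n)) ⟩
      ∣ a (n ℕ.∸ N ℕ.+ N) - a N ∣       ≤⟨ a≤ N (n ℕ.∸ N) ⟩
      K * ∣ t N ∣                       ≤⟨ *-monoˡ K 0≤K (<⇒≤ (h N ℕ.≤-refl)) ⟩
      K * δ ∎
    bound : ∀ δ N → (∀ n → N ℕ.≤ n → ∣ t n ∣ < δ) → ∀ m n → N ℕ.≤ m → N ℕ.≤ n → ∣ a m - a n ∣ ≤ (K + K) * δ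
    bound δ N h m n N≤m N≤n = begin
      ∣ a m - a n ∣ ≡⟨ cong ∣_∣ (solve 3 (λ x y z → x :- y := (x :- z) :+ (z :- y)) refl (a m) (a n) (a N)) ⟩
      ∣ (a m - a N) + (a N - a n) ∣ ≤⟨ ∣+∣-mono (step δ N h m N≤m) (≤-trans (≤-reflexive (∣p-q∣≡∣q-p∣ (a N) (a n))) (step δ N h n N≤n)) ⟩
      K * δ + K * δ ≡⟨ sym (*-distribʳ-+ δ K K) ⟩
      (K + K) * δ ∎

  infix 8 _⋆
  _⋆ : ℤ → ℚ
  z ⋆ = z / 1

  /-homo : ∀ x y m n .{{_ : ℕ.NonZero m}} .{{_ : ℕ.NonZero n}} .{{_ : ℕ.NonZero (m ℕ.* n)}} →
           (x ℤ.* y) / (m ℕ.* n) ≡ (x / m) * (y / n)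
  /-homo x y (suc m) (suc n) = toℚᵘ-injective (begin
    toℚᵘ (fromℚᵘ (X ℚᵘ.* Y))        ≈⟨ toℚᵘ-fromℚᵘ (X ℚᵘ.* Y) ⟩
    X ℚᵘ.* Y                          ≈⟨ ℚᵘ.*-cong (ℚᵘ.≃-sym (toℚᵘ-fromℚᵘ X)) (ℚᵘ.≃-sym (toℚᵘ-fromℚᵘ Y)) ⟩
    toℚᵘ (x / suc m) ℚᵘ.* toℚᵘ (y / suc n) ≈⟨ ℚᵘ.≃-sym (toℚᵘ-homo-* (x / suc m) (y / suc n)) ⟩
    toℚᵘ ((x / suc m) * (y / suc n)) ∎)
    where
    open ℚᵘ.≃-Reasoning
    X = ℚᵘ.mkℚᵘ x m
    Y = ℚᵘ.mkℚᵘ y n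

  u : ℕ → ℚ
  u k = ℤ.+ 1 / suc k

  pow : ℚ → ℕ → ℚ
  pow p zero    = 1ℚ
  pow p (suc n) = p * pow p n

  swap* : ∀ a b c → a * (b * c) ≡ b * (a * c)
  swap* = solve 3 (λ a b c → a :* (b :* c) := b :* (a :* c)) refl

  /-pow : ∀ z k s .{{_ : ℕ.NonZero (suc k ℕ.^ s)}} → z / (suc k ℕ.^ s) ≡ z ⋆ * pow (u k) s
  /-pow z k zero    = sym (*-identityʳ (z ⋆))
  /-pow z k (suc s) = begin
    z / (suc k ℕ.* suc k ℕ.^ s)               ≡⟨ /-cong {q₁ = suc k ℕ.* suc k ℕ.^ s} (sym (ℤ.*-identityˡ z)) refl ⟩
    (ℤ.+ 1 ℤ.* z) / (suc k ℕ.* suc k ℕ.^ s)     ≡⟨ /-homo (ℤ.+ 1) z (suc k) (suc k ℕ.^ s) ⟩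
    u k * (z / (suc k ℕ.^ s))                 ≡⟨ cong (u k *_) (/-pow z k s) ⟩
    u k * (z ⋆ * pow (u k) s)                 ≡⟨ swap* (u k) (z ⋆) (pow (u k) s) ⟩
    z ⋆ * (u k * pow (u k) s) ∎
    where
    open ≡-Reasoning
    instance
      nz : ℕ.NonZero (suc k ℕ.^ s)
      nz = ℕ.m^n≢0 (suc k) s

  0<u : ∀ k → 0ℚ < u k
  0<u k = positive⁻¹ (u k) {{normalize-pos 1 (suc k)}}

  0≤u : ∀ k → 0ℚ ≤ u k
  0≤u k = <⇒≤ (0<u k)

  u-step : ∀ k → u k ≡ u (suc k) + u k * u (suc k)
  u-step k = begin
    u k                                    ≡⟨ fromℚᵘ-cong {U} {V ℚᵘ.+ U ℚᵘ.* V} (ℚᵘ.*≡* eq) ⟩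
    fromℚᵘ (V ℚᵘ.+ U ℚᵘ.* V)               ≡⟨ toℚᵘ-injective lem ⟩
    u (suc k) + u k * u (suc k) ∎
    where
    open ≡-Reasoning
    U = ℚᵘ.mkℚᵘ (ℤ.+ 1) k
    V = ℚᵘ.mkℚᵘ (ℤ.+ 1) (suc k)
    ring : ∀ k → 1 ℕ.* (suc (suc k) ℕ.* (suc k ℕ.* suc (suc k))) ≡
                 (1 ℕ.* (suc k ℕ.* suc (suc k)) ℕ.+ 1 ℕ.* suc (suc k)) ℕ.* suc k
    ring = N.solve 1 (λ k → let x = N.con 1 N.:+ k ; y = N.con 2 N.:+ k in
             N.con 1 N.:* (y N.:* (x N.:* y)) N.:= (N.con 1 N.:* (x N.:* y) N.:+ N.con 1 N.:* y) N.:* x) refl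
      where module N = Data.Nat.Solver.+-*-Solver
    eq : ℚᵘ.↥ U ℤ.* ℚᵘ.↧ (V ℚᵘ.+ U ℚᵘ.* V) ≡ ℚᵘ.↥ (V ℚᵘ.+ U ℚᵘ.* V) ℤ.* ℚᵘ.↧ U
    eq = cong (λ n → ℤ.+ n) (ring k)
    lem : toℚᵘ (fromℚᵘ (V ℚᵘ.+ U ℚᵘ.* V)) ℚᵘ.≃ toℚᵘ (u (suc k) + u k * u (suc k))
    lem = ℚᵘ.≃-trans (toℚᵘ-fromℚᵘ (V ℚᵘ.+ U ℚᵘ.* V)) (ℚᵘ.≃-sym
          (ℚᵘ.≃-trans (toℚᵘ-homo-+ (u (suc k)) (u k * u (suc k)))
          (ℚᵘ.+-cong (toℚᵘ-fromℚᵘ V)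
          (ℚᵘ.≃-trans (toℚᵘ-homo-* (u k) (u (suc k)))
          (ℚᵘ.*-cong (toℚᵘ-fromℚᵘ U) (toℚᵘ-fromℚᵘ V))))))

  u-small : ∀ δ → 0ℚ < δ → ∃[ N ] u N < δ
  u-small δ 0<δ = go δ {{positive 0<δ}}
    where
    go : ∀ δ .{{_ : Positive δ}} → ∃[ N ] u N < δ
    go δ@(mkℚ (ℤ.+ suc a) d _) = suc d , toℚᵘ-cancel-< (ℚᵘ.<-respˡ-≃ (ℚᵘ.≃-sym (toℚᵘ-fromℚᵘ (ℚᵘ.mkℚᵘ (ℤ.+ 1) (suc d))))
      (ℚᵘ.*<* (ℤ.+<+ (ℕ.*-mono-≤ {1} {suc a} (ℕ.s≤s ℕ.z≤n) (ℕ.≤-refl {suc (suc d)})))))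

  p≤p+q : ∀ p {q} → 0ℚ ≤ q → p ≤ p + q
  p≤p+q p {q} 0≤q = subst (_≤ p + q) (+-identityʳ p) (+-monoʳ-≤ p 0≤q)

  u-anti : ∀ k → u (suc k) ≤ u k
  u-anti k = subst (u (suc k) ≤_) (sym (u-step k)) (p≤p+q (u (suc k)) (0≤* (0≤u k) (0≤u (suc k))))

  u-antitone : ∀ N d → u (d ℕ.+ N) ≤ u N
  u-antitone N zero    = ≤-refl
  u-antitone N (suc d) = ≤-trans (u-anti (d ℕ.+ N)) (u-antitone N d)

  u≤1 : ∀ k → u k ≤ 1ℚ
  u≤1 zero    = ≤-refl
  u≤1 (suc k) = ≤-trans (u-anti k) (u≤1 k)

  u≤2u : ∀ k → u k ≤ u (suc k) + u (suc k)
  u≤2u k = subst (_≤ u (suc k) + u (suc k)) (sym (u-step k))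
    (+-monoʳ-≤ (u (suc k)) (subst (u k * u (suc k) ≤_) (*-identityˡ (u (suc k)))
      (*-mono (0≤u k) (u≤1 k) (0≤u (suc k)) ≤-refl)))

  L : ℕ → ℚ
  L zero    = 1ℚ
  L (suc n) = L n + u n

  1≤L : ∀ n → 1ℚ ≤ L n
  1≤L zero    = ≤-refl
  1≤L (suc n) = ≤-trans (1≤L n) (p≤p+q (L n) (0≤u n))

  0≤L : ∀ n → 0ℚ ≤ L n
  0≤L n = ≤-trans 0≤1 (1≤L n)

  L'≤2L : ∀ n → L (suc n) ≤ 2ℚ * L n
  L'≤2L n = subst (L (suc n) ≤_) (solve 1 (λ x → x :+ x := con 2ℚ :* x) refl (L n))
    (+-monoʳ-≤ (L n) (≤-trans (u≤1 n) (1≤L n)))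

  0≤pow : ∀ {p} k → 0ℚ ≤ p → 0ℚ ≤ pow p k
  0≤pow zero    0≤p = 0≤1
  0≤pow (suc k) 0≤p = 0≤* 0≤p (0≤pow k 0≤p)

  pow-mono : ∀ {p q} k → 0ℚ ≤ p → p ≤ q → pow p k ≤ pow q k
  pow-mono zero    0≤p p≤q = ≤-refl
  pow-mono (suc k) 0≤p p≤q = *-mono 0≤p p≤q (0≤pow k 0≤p) (pow-mono k 0≤p p≤q)

  pow-1 : ∀ k → pow 1ℚ k ≡ 1ℚ
  pow-1 zero    = refl
  pow-1 (suc k) = trans (*-identityˡ (pow 1ℚ k)) (pow-1 k)

  pow-+ : ∀ p j k → pow p (j ℕ.+ k) ≡ pow p j * pow p k
  pow-+ p zero    k = sym (*-identityˡ (pow p k))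
  pow-+ p (suc j) k = trans (cong (p *_) (pow-+ p j k)) (sym (*-assoc p (pow p j) (pow p k)))

  pow-* : ∀ p q k → pow (p * q) k ≡ pow p k * pow q k
  pow-* p q zero    = refl
  pow-* p q (suc k) = trans (cong ((p * q) *_) (pow-* p q k))
    (solve 4 (λ a b c d → (a :* b) :* (c :* d) := (a :* c) :* (b :* d)) refl p q (pow p k) (pow q k))

  0≤L^ : ∀ n k → 0ℚ ≤ pow (L n) k
  0≤L^ n k = 0≤pow k (0≤L n)

  1≤L^ : ∀ n k → 1ℚ ≤ pow (L n) k
  1≤L^ n k = subst (_≤ pow (L n) k) (pow-1 k) (pow-mono k 0≤1 (1≤L n))

  L'^≤ : ∀ n k → pow (L (suc n)) k ≤ pow 2ℚ k * pow (L n) k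
  L'^≤ n k = subst (pow (L (suc n)) k ≤_) (pow-* 2ℚ (L n) k) (pow-mono k (0≤L (suc n)) (L'≤2L n))

  Δ-L^ : ∀ k → ∃[ E ] 0ℚ ≤ E × ∀ n → pow (L (suc n)) (suc k) ≤ pow (L n) (suc k) + E * (pow (L n) k * u n)
  Δ-L^ zero = 1ℚ , 0≤1 , λ n → ≤-reflexive (lem (L n) (u n))
    where
    lem : ∀ l v → (l + v) * 1ℚ ≡ l * 1ℚ + 1ℚ * (1ℚ * v)
    lem = solve 2 (λ l v → (l :+ v) :* con 1ℚ := l :* con 1ℚ :+ con 1ℚ :* (con 1ℚ :* v)) refl
  Δ-L^ (suc k) =
    let E , 0≤E , h = Δ-L^ k
    in 1ℚ + 2ℚ * E , ≤0+ 0≤1 (0≤* (nonNegative⁻¹ 2ℚ) 0≤E) , λ n → step E 0≤E n (h n)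
    where
    open ≤-Reasoning
    lem₁ : ∀ l v P X → (l + v) * (l * P) + (2ℚ * l) * X ≡ l * (l * P) + (l * P) * v + 2ℚ * (l * X)
    lem₁ = solve 4 (λ l v P X → (l :+ v) :* (l :* P) :+ (con 2ℚ :* l) :* X := l :* (l :* P) :+ (l :* P) :* v :+ con 2ℚ :* (l :* X)) refl
    lem₂ : ∀ l v P E → l * (l * P) + (l * P) * v + 2ℚ * (l * (E * (P * v))) ≡ l * (l * P) + (1ℚ + 2ℚ * E) * ((l * P) * v)
    lem₂ = solve 4 (λ l v P E → l :* (l :* P) :+ (l :* P) :* v :+ con 2ℚ :* (l :* (E :* (P :* v))) := l :* (l :* P) :+ (con 1ℚ :+ con 2ℚ :* E) :* ((l :* P) :* v)) refl
    step : ∀ E → 0ℚ ≤ E → ∀ n → pow (L (suc n)) (suc k) ≤ pow (L n) (suc k) + E * (pow (L n) k * u n) →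
           pow (L (suc n)) (suc (suc k)) ≤ pow (L n) (suc (suc k)) + (1ℚ + 2ℚ * E) * (pow (L n) (suc k) * u n)
    step E 0≤E n h = begin
      L (suc n) * pow (L (suc n)) (suc k)
        ≤⟨ *-monoˡ (L (suc n)) (0≤L (suc n)) h ⟩
      L (suc n) * (pow (L n) (suc k) + X)
        ≡⟨ *-distribˡ-+ (L (suc n)) (pow (L n) (suc k)) X ⟩
      L (suc n) * pow (L n) (suc k) + L (suc n) * X
        ≤⟨ +-monoʳ-≤ (L (suc n) * pow (L n) (suc k)) (*-mono (0≤L (suc n)) (L'≤2L n) 0≤X ≤-refl) ⟩
      L (suc n) * pow (L n) (suc k) + (2ℚ * L n) * X
        ≡⟨ trans (lem₁ (L n) (u n) (pow (L n) k) X) (lem₂ (L n) (u n) (pow (L n) k) E) ⟩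
      pow (L n) (suc (suc k)) + (1ℚ + 2ℚ * E) * (pow (L n) (suc k) * u n) ∎
      where
      X = E * (pow (L n) k * u n)
      0≤X : 0ℚ ≤ X
      0≤X = 0≤* 0≤E (0≤* (0≤L^ n k) (0≤u n))

  ⅓ 3ℚ : ℚ
  ⅓ = (ℤ.+ 1) / 3
  3ℚ = (ℤ.+ 3) / 1

  P : ℕ → ℚ
  P zero    = 1ℚ
  P (suc n) = P n + ⅓ * (u n * P n)

  0≤P : ∀ n → 0ℚ ≤ P n
  0≤P zero    = 0≤1
  0≤P (suc n) = ≤0+ (0≤P n) (0≤* (nonNegative⁻¹ ⅓) (0≤* (0≤u n) (0≤P n)))

  1≤P : ∀ n → 1ℚ ≤ P n
  1≤P zero    = ≤-refl
  1≤P (suc n) = ≤-trans (1≤P n) (p≤p+q (P n) (0≤* (nonNegative⁻¹ ⅓) (0≤* (0≤u n) (0≤P n))))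

  L^≤P : ∀ k → ∃[ D ] 0ℚ ≤ D × ∀ n → pow (L n) k ≤ D * P n
  L^≤P zero = 1ℚ , 0≤1 , λ n → subst (1ℚ ≤_) (sym (*-identityˡ (P n))) (1≤P n)
  L^≤P (suc k) =
    let D , 0≤D , h = L^≤P k
        E , 0≤E , g = Δ-L^ k
    in 1ℚ + 3ℚ * (E * D) , ≤0+ 0≤1 (0≤* (nonNegative⁻¹ 3ℚ) (0≤* 0≤E 0≤D)) , bound D E 0≤D 0≤E h g
    where
    open ≤-Reasoning
    lem : ∀ D E p v → (1ℚ + 3ℚ * (E * D)) * p + E * ((D * p) * v) + ⅓ * (v * p) ≡ (1ℚ + 3ℚ * (E * D)) * (p + ⅓ * (v * p))
    lem = solve 4 (λ D E p v → (con 1ℚ :+ con 3ℚ :* (E :* D)) :* p :+ E :* ((D :* p) :* v) :+ con ⅓ :* (v :* p) := (con 1ℚ :+ con 3ℚ :* (E :* D)) :* (p :+ con ⅓ :* (v :* p))) refl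
    bound : ∀ D E → 0ℚ ≤ D → 0ℚ ≤ E → (∀ n → pow (L n) k ≤ D * P n) →
            (∀ n → pow (L (suc n)) (suc k) ≤ pow (L n) (suc k) + E * (pow (L n) k * u n)) →
            ∀ n → pow (L n) (suc k) ≤ (1ℚ + 3ℚ * (E * D)) * P n
    bound D E 0≤D 0≤E h g zero = begin
      pow 1ℚ (suc k)              ≡⟨ pow-1 (suc k) ⟩
      1ℚ                          ≤⟨ p≤p+q 1ℚ (0≤* (nonNegative⁻¹ 3ℚ) (0≤* 0≤E 0≤D)) ⟩
      1ℚ + 3ℚ * (E * D)           ≡⟨ sym (*-identityʳ (1ℚ + 3ℚ * (E * D))) ⟩
      (1ℚ + 3ℚ * (E * D)) * 1ℚ ∎
    bound D E 0≤D 0≤E h g (suc n) = begin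
      pow (L (suc n)) (suc k)
        ≤⟨ g n ⟩
      pow (L n) (suc k) + E * (pow (L n) k * u n)
        ≤⟨ +-mono-≤ (bound D E 0≤D 0≤E h g n) (*-monoˡ E 0≤E (*-mono (0≤L^ n k) (h n) (0≤u n) ≤-refl)) ⟩
      (1ℚ + 3ℚ * (E * D)) * P n + E * ((D * P n) * u n)
        ≤⟨ p≤p+q ((1ℚ + 3ℚ * (E * D)) * P n + E * ((D * P n) * u n)) (0≤* (nonNegative⁻¹ ⅓) (0≤* (0≤u n) (0≤P n))) ⟩
      (1ℚ + 3ℚ * (E * D)) * P n + E * ((D * P n) * u n) + ⅓ * (u n * P n)
        ≡⟨ lem D E (P n) (u n) ⟩
      (1ℚ + 3ℚ * (E * D)) * P (suc n) ∎

  t : ℕ → ℚ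
  t n = P n * u n

  0≤t : ∀ n → 0ℚ ≤ t n
  0≤t n = 0≤* (0≤P n) (0≤u n)

  t-step : ∀ n → P n * (u n * u n) ≤ 3ℚ * (t n - t (suc n))
  t-step n = begin
    P n * (u n * u n)         ≤⟨ *-monoˡ (P n) (0≤P n) (*-monoˡ (u n) (0≤u n) (u≤2u n)) ⟩
    P n * (u n * (v + v))     ≡⟨ lem (P n) (u n) v ⟩
    3ℚ * (P n * (v + u n * v) - t (suc n)) ≡⟨ cong (λ x → 3ℚ * (P n * x - t (suc n))) (sym (u-step n)) ⟩
    3ℚ * (t n - t (suc n)) ∎
    where
    open ≤-Reasoning
    v = u (suc n)
    lem : ∀ p x v → p * (x * (v + v)) ≡ 3ℚ * (p * (v + x * v) - (p + ⅓ * (x * p)) * v)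
    lem = solve 3 (λ p x v → p :* (x :* (v :+ v)) := con 3ℚ :* (p :* (v :+ x :* v) :- (p :+ con ⅓ :* (x :* p)) :* v)) refl

  PPu≤1 : ∀ n → P n * P n * u n ≤ 1ℚ
  PPu≤1 zero    = ≤-refl
  PPu≤1 (suc n) = begin
    P (suc n) * P (suc n) * v         ≤⟨ p≤p+q (P (suc n) * P (suc n) * v) 0≤R ⟩
    P (suc n) * P (suc n) * v + R     ≡⟨ lem (P n) (u n) v ⟩
    P n * P n * (v + u n * v)         ≡⟨ cong (P n * P n *_) (sym (u-step n)) ⟩
    P n * P n * u n                   ≤⟨ PPu≤1 n ⟩
    1ℚ ∎
    where
    open ≤-Reasoning
    v = u (suc n)
    R = P n * P n * (u n * v) * (⅓ - ⅓ * ⅓ * u n)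
    0≤R : 0ℚ ≤ R
    0≤R = 0≤* (0≤* (0≤* (0≤P n) (0≤P n)) (0≤* (0≤u n) (0≤u (suc n))))
              (≤-trans (nonNegative⁻¹ (⅓ - ⅓ * ⅓ * 1ℚ))
                (+-monoʳ-≤ ⅓ (neg-antimono-≤ (*-monoˡ (⅓ * ⅓) (nonNegative⁻¹ (⅓ * ⅓)) (u≤1 n)))))
    lem : ∀ p x v → (p + ⅓ * (x * p)) * (p + ⅓ * (x * p)) * v + p * p * (x * v) * (⅓ - ⅓ * ⅓ * x) ≡ p * p * (v + x * v)
    lem = solve 3 (λ p x v → (p :+ con ⅓ :* (x :* p)) :* (p :+ con ⅓ :* (x :* p)) :* v :+ p :* p :* (x :* v) :* (con ⅓ :- con ⅓ :* con ⅓ :* x) := p :* p :* (v :+ x :* v)) refl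

  t²≤u : ∀ n → t n * t n ≤ u n
  t²≤u n = begin
    t n * t n                   ≡⟨ lem (P n) (u n) ⟩
    P n * P n * u n * u n       ≤⟨ *-mono (0≤* (0≤* (0≤P n) (0≤P n)) (0≤u n)) (PPu≤1 n) (0≤u n) ≤-refl ⟩
    1ℚ * u n                    ≡⟨ *-identityˡ (u n) ⟩
    u n ∎
    where
    open ≤-Reasoning
    lem : ∀ p x → (p * x) * (p * x) ≡ p * p * x * x
    lem = solve 2 (λ p x → (p :* x) :* (p :* x) := p :* p :* x :* x) refl

  Null-t : Null t
  Null-t ε 0<ε =
    let N , uN<ε² = u-small (ε * ε) (0<* 0<ε 0<ε)
    in N , λ n N≤n → subst (_< ε) (sym (0≤p⇒∣p∣≡p (0≤t n)))
         (≰⇒> λ ε≤t → <-irrefl refl (≤-<-trans (*-mono (<⇒≤ 0<ε) ε≤t (<⇒≤ 0<ε) ε≤t)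
           (≤-<-trans (t²≤u n) (≤-<-trans (subst (λ k → u k ≤ u N) (ℕ.m∸n+n≡m N≤n) (u-antitone N (n ℕ.∸ N))) uN<ε²))))

  Null-L : ∀ {c} C k → 0ℚ ≤ C → (∀ n → ∣ c n ∣ ≤ C * (pow (L n) k * u n)) → Null c
  Null-L {c} C k 0≤C h = let D , 0≤D , g = L^≤P k in Null-dom {t} (C * D) (0≤* 0≤C 0≤D) Null-t (bound D g)
    where
    open ≤-Reasoning
    bound : ∀ D → (∀ n → pow (L n) k ≤ D * P n) → ∀ n → ∣ c n ∣ ≤ C * D * ∣ t n ∣
    bound D g n = begin
      ∣ c n ∣ ≤⟨ h n ⟩
      C * (pow (L n) k * u n) ≤⟨ *-monoˡ C 0≤C (*-mono (0≤L^ n k) (g n) (0≤u n) ≤-refl) ⟩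
      C * (D * P n * u n)     ≡⟨ solve 4 (λ C D p v → C :* (D :* p :* v) := C :* D :* (p :* v)) refl C D (P n) (u n) ⟩
      C * D * t n             ≡⟨ cong (C * D *_) (sym (0≤p⇒∣p∣≡p (0≤t n))) ⟩
      C * D * ∣ t n ∣ ∎

  Cauchy-L : ∀ {a} C k → 0ℚ ≤ C → (∀ n → ∣ a (suc n) - a n ∣ ≤ C * (pow (L n) k * (u n * u n))) → IsCauchy a
  Cauchy-L {a} C k 0≤C h =
    let D , 0≤D , g = L^≤P k
        0≤K = 0≤* (0≤* 0≤C 0≤D) (nonNegative⁻¹ 3ℚ)
    in Cauchy-dom {a} {t} (C * D * 3ℚ) 0≤K Null-t λ N d →
       ≤-trans (tail D 0≤D g N d) (*-monoˡ (C * D * 3ℚ) 0≤K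
         (≤-trans (p-q≤p (t N) (0≤t (d ℕ.+ N))) (≤-reflexive (sym (0≤p⇒∣p∣≡p (0≤t N))))))
    where
    open ≤-Reasoning
    step : ∀ D → 0ℚ ≤ D → (∀ n → pow (L n) k ≤ D * P n) → ∀ n → ∣ a (suc n) - a n ∣ ≤ C * D * 3ℚ * (t n - t (suc n))
    step D 0≤D g n = begin
      ∣ a (suc n) - a n ∣ ≤⟨ h n ⟩
      C * (pow (L n) k * (u n * u n)) ≤⟨ *-monoˡ C 0≤C (*-mono (0≤L^ n k) (g n) (0≤* (0≤u n) (0≤u n)) ≤-refl) ⟩
      C * (D * P n * (u n * u n))     ≡⟨ solve 4 (λ C D p v → C :* (D :* p :* (v :* v)) := C :* D :* (p :* (v :* v))) refl C D (P n) (u n) ⟩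
      C * D * (P n * (u n * u n))     ≤⟨ *-monoˡ (C * D) (0≤* 0≤C 0≤D) (t-step n) ⟩
      C * D * (3ℚ * (t n - t (suc n))) ≡⟨ sym (*-assoc (C * D) 3ℚ (t n - t (suc n))) ⟩
      C * D * 3ℚ * (t n - t (suc n)) ∎
    tail : ∀ D → 0ℚ ≤ D → (∀ n → pow (L n) k ≤ D * P n) → ∀ N d → ∣ a (d ℕ.+ N) - a N ∣ ≤ C * D * 3ℚ * (t N - t (d ℕ.+ N))
    tail D 0≤D g N zero = ≤-reflexive (trans (cong ∣_∣ (+-inverseʳ (a N)))
      (sym (trans (cong (C * D * 3ℚ *_) (+-inverseʳ (t N))) (*-zeroʳ (C * D * 3ℚ)))))
    tail D 0≤D g N (suc d) = begin
      ∣ a (suc n) - a N ∣ ≡⟨ cong ∣_∣ (split (a (suc n)) (a n) (a N)) ⟩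
      ∣ (a (suc n) - a n) + (a n - a N) ∣ ≤⟨ ∣+∣-mono (step D 0≤D g n) (tail D 0≤D g N d) ⟩
      K * (t n - t (suc n)) + K * (t N - t n) ≡⟨ join K (t n) (t (suc n)) (t N) ⟩
      K * (t N - t (suc n)) ∎
      where
      n = d ℕ.+ N
      K = C * D * 3ℚ
      split : ∀ x y z → x - z ≡ (x - y) + (y - z)
      split = solve 3 (λ x y z → x :- z := (x :- y) :+ (y :- z)) refl
      join : ∀ K x y z → K * (x - y) + K * (z - x) ≡ K * (z - y)
      join = solve 4 (λ K x y z → K :* (x :- y) :+ K :* (z :- x) := K :* (z :- y)) refl

  record Tame (g : ℕ → ℚ) : Set where
    constructor tame
    field
      C     : ℚ
      k     : ℕ
      0≤C   : 0ℚ ≤ C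
      bound : ∀ n → ∣ g n ∣ ≤ C * pow (L n) k
      diff  : ∀ n → ∣ g (suc n) - g n ∣ ≤ C * (pow (L n) k * u n)

  Tame-resp : ∀ {g h : ℕ → ℚ} → (∀ n → g n ≡ h n) → Tame g → Tame h
  Tame-resp g≡h (tame C k 0≤C b d) = tame C k 0≤C
    (λ n → subst (λ x → ∣ x ∣ ≤ C * pow (L n) k) (g≡h n) (b n))
    (λ n → subst₂ (λ x y → ∣ x - y ∣ ≤ C * (pow (L n) k * u n)) (g≡h (suc n)) (g≡h n) (d n))

  Tame-suc : ∀ {g : ℕ → ℚ} → Tame g → Tame (λ n → g (suc n))
  Tame-suc {g} (tame C k 0≤C b d) = tame (C * pow 2ℚ k) k (0≤* 0≤C (0≤pow k (nonNegative⁻¹ 2ℚ)))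
    (λ n → begin
      ∣ g (suc n) ∣                      ≤⟨ b (suc n) ⟩
      C * pow (L (suc n)) k              ≤⟨ *-monoˡ C 0≤C (L'^≤ n k) ⟩
      C * (pow 2ℚ k * pow (L n) k)       ≡⟨ sym (*-assoc C (pow 2ℚ k) (pow (L n) k)) ⟩
      C * pow 2ℚ k * pow (L n) k ∎)
    (λ n → begin
      ∣ g (suc (suc n)) - g (suc n) ∣              ≤⟨ d (suc n) ⟩
      C * (pow (L (suc n)) k * u (suc n))          ≤⟨ *-monoˡ C 0≤C (*-mono (0≤L^ (suc n) k) (L'^≤ n k) (0≤u (suc n)) (u-anti n)) ⟩
      C * (pow 2ℚ k * pow (L n) k * u n)           ≡⟨ lem C (pow 2ℚ k) (pow (L n) k) (u n) ⟩
      C * pow 2ℚ k * (pow (L n) k * u n) ∎)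
    where
    open ≤-Reasoning
    lem : ∀ a b c d → a * (b * c * d) ≡ a * b * (c * d)
    lem = solve 4 (λ a b c d → a :* (b :* c :* d) := a :* b :* (c :* d)) refl

  Tame-pow-u : ∀ r → Tame (λ n → pow (u n) r)
  Tame-pow-u r = tame 1ℚ 0 0≤1
    (λ n → subst (_≤ 1ℚ) (sym (0≤p⇒∣p∣≡p (0≤pow r (0≤u n))))
             (subst (pow (u n) r ≤_) (pow-1 r) (pow-mono r (0≤u n) (u≤1 n))))
    (λ n → subst (∣ pow (u (suc n)) r - pow (u n) r ∣ ≤_)
             (sym (trans (*-identityˡ (1ℚ * u n)) (*-identityˡ (u n)))) (diff r n))
    where
    pow≤ : ∀ r n → pow (u n) (suc r) ≤ u n
    pow≤ r n = subst (pow (u n) (suc r) ≤_) (*-identityʳ (u n))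
      (*-monoˡ (u n) (0≤u n) (subst (pow (u n) r ≤_) (pow-1 r) (pow-mono r (0≤u n) (u≤1 n))))
    diff : ∀ r n → ∣ pow (u (suc n)) r - pow (u n) r ∣ ≤ u n
    diff zero    n = 0≤u n
    diff (suc r) n = ∣p-q∣≤ (0≤pow (suc r) (0≤u (suc n))) (≤-trans (pow≤ r (suc n)) (u-anti n))
                            (0≤pow (suc r) (0≤u n)) (pow≤ r n)

  Tame-1 : Tame (λ _ → 1ℚ)
  Tame-1 = Tame-pow-u 0

  Tame-* : ∀ {g h : ℕ → ℚ} → Tame g → Tame h → Tame (λ n → g n * h n)
  Tame-* {g} {h} (tame C k 0≤C b d) (tame C′ k′ 0≤C′ b′ d′) =
    tame (3ℚ * (C * C′)) (k ℕ.+ k′) (0≤* (nonNegative⁻¹ 3ℚ) 0≤CC′) bound diff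
    where
    open ≤-Reasoning
    0≤CC′ = 0≤* 0≤C 0≤C′
    lem₁ : ∀ a b c d → a * b * (c * d) + (a * c) * (b * d) + (a * c) * (b * d) ≡ 3ℚ * (a * c) * (b * d)
    lem₁ = solve 4 (λ a b c d → a :* b :* (c :* d) :+ (a :* c) :* (b :* d) :+ (a :* c) :* (b :* d) := con 3ℚ :* (a :* c) :* (b :* d)) refl
    lem₂ : ∀ C C′ X Y v → (C * X + C * X) * (C′ * (Y * v)) + C * (X * v) * (C′ * Y) ≡ 3ℚ * (C * C′) * ((X * Y) * v)
    lem₂ = solve 5 (λ C C′ X Y v → (C :* X :+ C :* X) :* (C′ :* (Y :* v)) :+ C :* (X :* v) :* (C′ :* Y) := con 3ℚ :* (C :* C′) :* ((X :* Y) :* v)) refl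
    lem₃ : ∀ x x′ y y′ → x′ * y′ - x * y ≡ x′ * (y′ - y) + (x′ - x) * y
    lem₃ = solve 4 (λ x x′ y y′ → x′ :* y′ :- x :* y := x′ :* (y′ :- y) :+ (x′ :- x) :* y) refl
    lem₄ : ∀ x x′ → x′ ≡ x + (x′ - x)
    lem₄ = solve 2 (λ x x′ → x′ := x :+ (x′ :- x)) refl
    bound : ∀ n → ∣ g n * h n ∣ ≤ 3ℚ * (C * C′) * pow (L n) (k ℕ.+ k′)
    bound n = begin
      ∣ g n * h n ∣                                            ≤⟨ ∣*∣-mono (b n) (b′ n) ⟩
      C * X * (C′ * Y)                                         ≤⟨ ≤-trans (p≤p+q (C * X * (C′ * Y)) 0≤Z) (p≤p+q (C * X * (C′ * Y) + C * C′ * (X * Y)) 0≤Z) ⟩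
      C * X * (C′ * Y) + C * C′ * (X * Y) + C * C′ * (X * Y)   ≡⟨ lem₁ C X C′ Y ⟩
      3ℚ * (C * C′) * (X * Y)                                  ≡⟨ cong (3ℚ * (C * C′) *_) (sym (pow-+ (L n) k k′)) ⟩
      3ℚ * (C * C′) * pow (L n) (k ℕ.+ k′) ∎
      where
      X = pow (L n) k
      Y = pow (L n) k′
      0≤Z : 0ℚ ≤ C * C′ * (X * Y)
      0≤Z = 0≤* 0≤CC′ (0≤* (0≤L^ n k) (0≤L^ n k′))
    bound⁺ : ∀ n → ∣ g (suc n) ∣ ≤ C * pow (L n) k + C * pow (L n) k
    bound⁺ n = begin
      ∣ g (suc n) ∣                                ≡⟨ cong ∣_∣ (lem₄ (g n) (g (suc n))) ⟩
      ∣ g n + (g (suc n) - g n) ∣                  ≤⟨ ∣+∣-mono (b n) (d n) ⟩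
      C * pow (L n) k + C * (pow (L n) k * u n)    ≤⟨ +-monoʳ-≤ (C * pow (L n) k) (*-monoˡ C 0≤C (*-monoˡ (pow (L n) k) (0≤L^ n k) (u≤1 n))) ⟩
      C * pow (L n) k + C * (pow (L n) k * 1ℚ)     ≡⟨ cong (λ x → C * pow (L n) k + C * x) (*-identityʳ (pow (L n) k)) ⟩
      C * pow (L n) k + C * pow (L n) k ∎
    diff : ∀ n → ∣ g (suc n) * h (suc n) - g n * h n ∣ ≤ 3ℚ * (C * C′) * (pow (L n) (k ℕ.+ k′) * u n)
    diff n = begin
      ∣ g (suc n) * h (suc n) - g n * h n ∣                         ≡⟨ cong ∣_∣ (lem₃ (g n) (g (suc n)) (h n) (h (suc n))) ⟩
      ∣ g (suc n) * (h (suc n) - h n) + (g (suc n) - g n) * h n ∣   ≤⟨ ∣+∣-mono (∣*∣-mono (bound⁺ n) (d′ n)) (∣*∣-mono (d n) (b′ n)) ⟩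
      (C * X + C * X) * (C′ * (Y * u n)) + C * (X * u n) * (C′ * Y) ≡⟨ lem₂ C C′ X Y (u n) ⟩
      3ℚ * (C * C′) * ((X * Y) * u n)                               ≡⟨ cong (λ x → 3ℚ * (C * C′) * (x * u n)) (sym (pow-+ (L n) k k′)) ⟩
      3ℚ * (C * C′) * (pow (L n) (k ℕ.+ k′) * u n) ∎
      where
      X = pow (L n) k
      Y = pow (L n) k′

  term-bound : ∀ {s g : ℕ → ℚ} → (∀ n → ∣ s n ∣ ≤ 1ℚ) → (G : Tame g) → ∀ n →
               ∣ s n * (u n * g n) ∣ ≤ Tame.C G * (pow (L n) (Tame.k G) * u n)
  term-bound {s} {g} s≤1 (tame C k 0≤C b d) n = begin
    ∣ s n * (u n * g n) ∣          ≤⟨ ∣*∣-mono (s≤1 n) (∣*∣-mono (≤-reflexive (0≤p⇒∣p∣≡p (0≤u n))) (b n)) ⟩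
    1ℚ * (u n * (C * pow (L n) k)) ≡⟨ lem (u n) C (pow (L n) k) ⟩
    C * (pow (L n) k * u n) ∎
    where
    open ≤-Reasoning
    lem : ∀ a b c → 1ℚ * (a * (b * c)) ≡ b * (c * a)
    lem = solve 3 (λ a b c → con 1ℚ :* (a :* (b :* c)) := b :* (c :* a)) refl

  x+y-x≡y : ∀ x y → (x + y) - x ≡ y
  x+y-x≡y = solve 2 (λ x y → (x :+ y) :- x := y) refl

  Tame-∑ : ∀ {s g : ℕ → ℚ} → (∀ n → ∣ s n ∣ ≤ 1ℚ) → Tame g → Tame (λ N → ∑< N (λ n → s n * (u n * g n)))
  Tame-∑ {s} {g} s≤1 G@(tame C k 0≤C b d) = tame C (suc k) 0≤C bound diff
    where
    open ≤-Reasoning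
    f = λ n → s n * (u n * g n)
    lem : ∀ C l X v → C * (l * X) + C * (X * v) ≡ C * ((l + v) * X)
    lem = solve 4 (λ C l X v → C :* (l :* X) :+ C :* (X :* v) := C :* ((l :+ v) :* X)) refl
    bound : ∀ N → ∣ ∑< N f ∣ ≤ C * pow (L N) (suc k)
    bound zero    = 0≤* 0≤C (0≤L^ 0 (suc k))
    bound (suc N) = begin
      ∣ ∑< N f + f N ∣                                            ≤⟨ ∣+∣-mono (bound N) (term-bound {s} {g} s≤1 G N) ⟩
      C * (L N * pow (L N) k) + C * (pow (L N) k * u N)           ≡⟨ lem C (L N) (pow (L N) k) (u N) ⟩
      C * (L (suc N) * pow (L N) k)                               ≤⟨ *-monoˡ C 0≤C (*-monoˡ (L (suc N)) (0≤L (suc N)) (pow-mono k (0≤L N) (p≤p+q (L N) (0≤u N)))) ⟩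
      C * (L (suc N) * pow (L (suc N)) k) ∎
    diff : ∀ N → ∣ ∑< (suc N) f - ∑< N f ∣ ≤ C * (pow (L N) (suc k) * u N)
    diff N = begin
      ∣ ∑< (suc N) f - ∑< N f ∣           ≡⟨ cong ∣_∣ (x+y-x≡y (∑< N f) (f N)) ⟩
      ∣ f N ∣                             ≤⟨ term-bound {s} {g} s≤1 G N ⟩
      C * (pow (L N) k * u N)             ≡⟨ cong (λ x → C * (x * u N)) (sym (*-identityˡ (pow (L N) k))) ⟩
      C * (1ℚ * pow (L N) k * u N)        ≤⟨ *-monoˡ C 0≤C (*-mono (0≤* 0≤1 (0≤L^ N k)) (*-mono 0≤1 (1≤L N) (0≤L^ N k) ≤-refl) (0≤u N) ≤-refl) ⟩
      C * (L N * pow (L N) k * u N) ∎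

  Cauchy-abs : ∀ {s g : ℕ → ℚ} → (∀ n → ∣ s n ∣ ≤ 1ℚ) → Tame g → IsCauchy (λ N → ∑< N (λ n → s n * (u n * (u n * g n))))
  Cauchy-abs {s} {g} s≤1 (tame C k 0≤C b d) = Cauchy-L {λ N → ∑< N f} C k 0≤C λ N → begin
      ∣ ∑< (suc N) f - ∑< N f ∣                        ≡⟨ cong ∣_∣ (x+y-x≡y (∑< N f) (f N)) ⟩
      ∣ f N ∣                                          ≤⟨ ∣*∣-mono (s≤1 N) (∣*∣-mono (∣u∣≤ N) (∣*∣-mono (∣u∣≤ N) (b N))) ⟩
      1ℚ * (u N * (u N * (C * pow (L N) k)))           ≡⟨ lem (u N) C (pow (L N) k) ⟩
      C * (pow (L N) k * (u N * u N)) ∎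
    where
    open ≤-Reasoning
    f = λ n → s n * (u n * (u n * g n))
    ∣u∣≤ : ∀ n → ∣ u n ∣ ≤ u n
    ∣u∣≤ n = ≤-reflexive (0≤p⇒∣p∣≡p (0≤u n))
    lem : ∀ a b c → 1ℚ * (a * (a * (b * c))) ≡ b * (c * (a * a))
    lem = solve 3 (λ a b c → con 1ℚ :* (a :* (a :* (b :* c))) := b :* (c :* (a :* a))) refl

  Cauchy-Null : ∀ {a b} → IsCauchy a → Null b → IsCauchy (λ n → a n + b n)
  Cauchy-Null {a} {b} ca nb ε 0<ε =
    let N , h = ca (½ * ε) 0<½ε
        M , g = nb (½ * (½ * ε)) (0<* (positive⁻¹ ½) 0<½ε)
    in N ℕ.⊔ M , λ m n N≤m N≤n →
       subst₂ _<_ (cong ∣_∣ (sym (lem₁ (a m) (b m) (a n) (b n)))) (lem₂ ε)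
         (≤-<-trans (≤-trans (∣p+q∣≤∣p∣+∣q∣ (a m - a n) (b m - b n)) (+-monoʳ-≤ ∣ a m - a n ∣ (∣p-q∣≤∣p∣+∣q∣ (b m) (b n))))
           (+-mono-< (h m n (ℕ.m⊔n≤o⇒m≤o N M N≤m) (ℕ.m⊔n≤o⇒m≤o N M N≤n))
             (+-mono-< (g m (ℕ.m⊔n≤o⇒n≤o N M N≤m)) (g n (ℕ.m⊔n≤o⇒n≤o N M N≤n)))))
    where
    0<½ε = 0<* (positive⁻¹ ½) 0<ε
    lem₁ : ∀ x y x′ y′ → (x + y) - (x′ + y′) ≡ (x - x′) + (y - y′)
    lem₁ = solve 4 (λ x y x′ y′ → (x :+ y) :- (x′ :+ y′) := (x :- x′) :+ (y :- y′)) refl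
    lem₂ : ∀ ε → ½ * ε + (½ * (½ * ε) + ½ * (½ * ε)) ≡ ε
    lem₂ = solve 1 (λ ε → con ½ :* ε :+ (con ½ :* (con ½ :* ε) :+ con ½ :* (con ½ :* ε)) := ε) refl

  -- summation by parts: 2 ∑_{n<N} s n f n = (2 ∑_{n<N} s n f n + s N f N) - s N f N,
  -- whose bracket has increments - s n (f (n+1) - f n)
  Cauchy-alt : ∀ {s g : ℕ → ℚ} → (∀ n → ∣ s n ∣ ≤ 1ℚ) → (∀ n → s (suc n) ≡ - s n) → Tame g →
               IsCauchy (λ N → ∑< N (λ n → s n * (u n * g n)))
  Cauchy-alt {s} {g} s≤1 s-alt G@(tame C k 0≤C b d) =
    subst-Cauchy (Cauchy-Null {A} {B} cauchy-A null-B)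
    where
    open ≤-Reasoning
    f = λ n → u n * g n
    S = λ N → ∑< N (λ n → s n * f n)
    A B : ℕ → ℚ
    A N = S N + ½ * (s N * f N)
    B N = - ½ * (s N * f N)
    subst-Cauchy : IsCauchy (λ n → A n + B n) → IsCauchy S
    subst-Cauchy c ε 0<ε = let N , h = c ε 0<ε in N , λ m n N≤m N≤n →
      subst₂ (λ x y → ∣ x - y ∣ < ε) (lem (S m) (s m * f m)) (lem (S n) (s n * f n)) (h m n N≤m N≤n)
      where
      lem : ∀ x y → (x + ½ * y) + - ½ * y ≡ x
      lem = solve 2 (λ x y → (x :+ con ½ :* y) :+ con (- ½) :* y := x) refl
    null-B : Null B
    null-B = Null-L {B} C k 0≤C λ n → begin
      ∣ - ½ * (s n * f n) ∣                    ≤⟨ ∣*∣-mono {r = s n * f n} (≤-refl {∣ - ½ ∣}) (term-bound {s} {g} s≤1 G n) ⟩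
      ½ * (C * (pow (L n) k * u n))            ≤⟨ *-monoʳ-≤-nonNeg (C * (pow (L n) k * u n)) {{nonNegative (0≤* 0≤C (0≤* (0≤L^ n k) (0≤u n)))}} (≤ᵇ⇒≤ {½} {1ℚ} _) ⟩
      1ℚ * (C * (pow (L n) k * u n))           ≡⟨ *-identityˡ (C * (pow (L n) k * u n)) ⟩
      C * (pow (L n) k * u n) ∎
    Δf : ∀ n → ∣ f n - f (suc n) ∣ ≤ 2ℚ * (C * (pow (L n) k * (u n * u n)))
    Δf n = begin
      ∣ x * y - x′ * y′ ∣                      ≡⟨ cong (λ z → ∣ z * y - x′ * y′ ∣) (u-step n) ⟩
      ∣ (x′ + x * x′) * y - x′ * y′ ∣          ≡⟨ cong ∣_∣ (lem₁ x x′ y y′) ⟩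
      ∣ x′ * (x * y + - (y′ - y)) ∣            ≤⟨ ∣*∣-mono (≤-trans (≤-reflexive (0≤p⇒∣p∣≡p (0≤u (suc n)))) (u-anti n))
                                                    (∣+∣-mono (∣*∣-mono (≤-reflexive (0≤p⇒∣p∣≡p (0≤u n))) (b n))
                                                      (≤-trans (≤-reflexive (∣-p∣≡∣p∣ (y′ - y))) (d n))) ⟩
      x * (x * (C * X) + C * (X * x))          ≡⟨ lem₂ x C X ⟩
      2ℚ * (C * (X * (x * x))) ∎
      where
      x = u n
      x′ = u (suc n)
      y = g n
      y′ = g (suc n)
      X = pow (L n) k
      lem₁ : ∀ x x′ y y′ → (x′ + x * x′) * y - x′ * y′ ≡ x′ * (x * y + - (y′ - y))
      lem₁ = solve 4 (λ x x′ y y′ → (x′ :+ x :* x′) :* y :- x′ :* y′ := x′ :* (x :* y :+ :- (y′ :- y))) refl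
      lem₂ : ∀ x C X → x * (x * (C * X) + C * (X * x)) ≡ 2ℚ * (C * (X * (x * x)))
      lem₂ = solve 3 (λ x C X → x :* (x :* (C :* X) :+ C :* (X :* x)) := con 2ℚ :* (C :* (X :* (x :* x)))) refl
    cauchy-A : IsCauchy A
    cauchy-A = Cauchy-L {A} C k 0≤C λ n → begin
      ∣ A (suc n) - A n ∣                              ≡⟨ cong (λ z → ∣ (S n + s n * f n + ½ * (z * f (suc n))) - A n ∣) (s-alt n) ⟩
      ∣ (S n + s n * f n + ½ * (- s n * f (suc n))) - A n ∣   ≡⟨ cong ∣_∣ (lem (S n) (s n) (f n) (f (suc n))) ⟩
      ∣ ½ * (s n * (f n - f (suc n))) ∣                ≤⟨ ∣*∣-mono {r = s n * (f n - f (suc n))} (≤-refl {∣ ½ ∣}) (∣*∣-mono (s≤1 n) (Δf n)) ⟩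
      ½ * (1ℚ * (2ℚ * Y n))                            ≡⟨ lem₃ (Y n) ⟩
      Y n ∎
      where
      Y : ℕ → ℚ
      Y n = C * (pow (L n) k * (u n * u n))
      lem : ∀ S s x x′ → (S + s * x + ½ * (- s * x′)) - (S + ½ * (s * x)) ≡ ½ * (s * (x - x′))
      lem = solve 4 (λ S s x x′ → (S :+ s :* x :+ con ½ :* (:- s :* x′)) :- (S :+ con ½ :* (s :* x)) := con ½ :* (s :* (x :- x′))) refl
      lem₃ : ∀ y → ½ * (1ℚ * (2ℚ * y)) ≡ y
      lem₃ = solve 1 (λ y → con ½ :* (con 1ℚ :* (con 2ℚ :* y)) := y) refl

  ∑<-cong : ∀ {f g} → (∀ n → f n ≡ g n) → ∀ N → ∑< N f ≡ ∑< N g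
  ∑<-cong f≡g zero    = refl
  ∑<-cong f≡g (suc N) = cong₂ _+_ (∑<-cong f≡g N) (f≡g N)

  Cauchy-resp : ∀ {a b} → (∀ n → a n ≡ b n) → IsCauchy a → IsCauchy b
  Cauchy-resp a≡b c ε 0<ε = let N , h = c ε 0<ε in N , λ m n N≤m N≤n →
    subst₂ (λ x y → ∣ x - y ∣ < ε) (a≡b m) (a≡b n) (h m n N≤m N≤n)

  Cauchy-+ : ∀ {a b : ℕ → ℚ} → IsCauchy a → IsCauchy b → IsCauchy (λ n → a n + b n)
  Cauchy-+ {a} {b} ca cb ε 0<ε =
    let N , h = ca (½ * ε) 0<½ε
        M , g = cb (½ * ε) 0<½ε
    in N ℕ.⊔ M , λ m n N≤m N≤n →
       subst₂ _<_ (cong ∣_∣ (sym (lem₁ (a m) (b m) (a n) (b n)))) (lem₂ ε)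
         (≤-<-trans (∣p+q∣≤∣p∣+∣q∣ (a m - a n) (b m - b n))
           (+-mono-< (h m n (ℕ.m⊔n≤o⇒m≤o N M N≤m) (ℕ.m⊔n≤o⇒m≤o N M N≤n))
                     (g m n (ℕ.m⊔n≤o⇒n≤o N M N≤m) (ℕ.m⊔n≤o⇒n≤o N M N≤n))))
    where
    0<½ε = 0<* (positive⁻¹ ½) 0<ε
    lem₁ : ∀ x y x′ y′ → (x + y) - (x′ + y′) ≡ (x - x′) + (y - y′)
    lem₁ = solve 4 (λ x y x′ y′ → (x :+ y) :- (x′ :+ y′) := (x :- x′) :+ (y :- y′)) refl
    lem₂ : ∀ ε → ½ * ε + ½ * ε ≡ ε
    lem₂ = solve 1 (λ ε → con ½ :* ε :+ con ½ :* ε := ε) refl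

  Cauchy-· : ∀ {a : ℕ → ℚ} r → IsCauchy a → IsCauchy (λ n → r * a n)
  Cauchy-· {a} r ca ε 0<ε =
    let δ , 0<δ , rδ<ε = small-mult ∣ r ∣ ε (0≤∣p∣ r) 0<ε
        N , h = ca δ 0<δ
    in N , λ m n N≤m N≤n → ≤-<-trans (bound δ m n (<⇒≤ (h m n N≤m N≤n))) rδ<ε
    where
    lem : ∀ r x y → r * x - r * y ≡ r * (x - y)
    lem = solve 3 (λ r x y → r :* x :- r :* y := r :* (x :- y)) refl
    bound : ∀ δ m n → ∣ a m - a n ∣ ≤ δ → ∣ r * a m - r * a n ∣ ≤ ∣ r ∣ * δ
    bound δ m n h = subst (_≤ ∣ r ∣ * δ) (cong ∣_∣ (sym (lem r (a m) (a n))))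
      (∣*∣-mono (≤-refl {∣ r ∣}) h)

  neg⋆ : ∀ z → (-1ℤ ℤ.* z) ⋆ ≡ - (z ⋆)
  neg⋆ z = trans (/-homo -1ℤ z 1 1) (lem (z ⋆))
    where
    lem : ∀ x → - 1ℚ * x ≡ - x
    lem = solve 1 (λ x → con (- 1ℚ) :* x := :- x) refl

  ∣sign∣≤1 : ∀ σ n → ∣ ((σ ◃ 1) ℤ.^ n) ⋆ ∣ ≤ 1ℚ
  ∣sign∣≤1 Sign.- zero    = ≤-refl
  ∣sign∣≤1 Sign.- (suc n) = subst (_≤ 1ℚ)
    (sym (trans (cong ∣_∣ (neg⋆ (-1ℤ ℤ.^ n))) (∣-p∣≡∣p∣ ((-1ℤ ℤ.^ n) ⋆)))) (∣sign∣≤1 Sign.- n)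
  ∣sign∣≤1 Sign.+ n       = subst (λ z → ∣ z ⋆ ∣ ≤ 1ℚ) (sym (ℤ.^-zeroˡ n)) ≤-refl

  term-eq : ∀ z s .{{_ : ℕ.NonZero (suc s)}} k g →
            z /[1+ k ]^ mk⁺ (suc s) * g ≡ z ⋆ * (u k * (pow (u k) s * g))
  term-eq z s k g = trans (cong (_* g) (/-pow z k (suc s) {{ℕ.m^n≢0 (suc k) (suc s)}}))
                          (lem (z ⋆) (u k) (pow (u k) s) g)
    where
    lem : ∀ a b c d → (a * (b * c)) * d ≡ a * (b * (c * d))
    lem = solve 4 (λ a b c d → (a :* (b :* c)) :* d := a :* (b :* (c :* d))) refl

  Tame-series : ∀ {z : ℕ → ℤ} {g : ℕ → ℚ} → (∀ n → ∣ z n ⋆ ∣ ≤ 1ℚ) → ∀ s → Tame g →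
                Tame (λ N → ∑< N (λ k → z k /[1+ k ]^ s * g k))
  Tame-series {z} {g} z≤1 (mk⁺ (suc s)) G =
    Tame-resp (∑<-cong (λ k → sym (term-eq (z k) s k (g k))))
      (Tame-∑ {λ k → z k ⋆} {λ k → pow (u k) s * g k} z≤1 (Tame-* (Tame-pow-u s) G))

  Cauchy-series-alt : ∀ {z : ℕ → ℤ} {g : ℕ → ℚ} → (∀ n → ∣ z n ⋆ ∣ ≤ 1ℚ) →
                      (∀ n → z (suc n) ≡ -1ℤ ℤ.* z n) → ∀ s → Tame g →
                      IsCauchy (λ N → ∑< N (λ k → z k /[1+ k ]^ s * g k))
  Cauchy-series-alt {z} {g} z≤1 z-alt (mk⁺ (suc s)) G =
    Cauchy-resp (∑<-cong (λ k → sym (term-eq (z k) s k (g k))))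
      (Cauchy-alt {λ k → z k ⋆} {λ k → pow (u k) s * g k} z≤1 (λ n → trans (cong _⋆ (z-alt n)) (neg⋆ (z n))) (Tame-* (Tame-pow-u s) G))

  Cauchy-series-abs : ∀ {z : ℕ → ℤ} {g : ℕ → ℚ} → (∀ n → ∣ z n ⋆ ∣ ≤ 1ℚ) → ∀ s → ¬ value s ≡ 1 → Tame g →
                      IsCauchy (λ N → ∑< N (λ k → z k /[1+ k ]^ s * g k))
  Cauchy-series-abs         z≤1 (mk⁺ 1)             s≢1 G = contradiction refl s≢1
  Cauchy-series-abs {z} {g} z≤1 (mk⁺ (suc (suc s))) s≢1 G =
    Cauchy-resp (∑<-cong (λ k → sym (trans (term-eq (z k) (suc s) k (g k))
                   (cong (λ x → z k ⋆ * (u k * x)) (*-assoc (u k) (pow (u k) s) (g k))))))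
      (Cauchy-abs {λ k → z k ⋆} {λ k → pow (u k) s * g k} z≤1 (Tame-* (Tame-pow-u s) G))

  Tame-∏ : ∀ {m} {g : ℕ → Vector ℚ m} → (∀ j → Tame (λ n → g n j)) → Tame (λ n → ∏ (g n))
  Tame-∏ {zero}  G = Tame-1
  Tame-∏ {suc m} G = Tame-* (G Fin.zero) (Tame-∏ (G ∘ Fin.suc))

  Tame-harmonic : ∀ {z : ℕ → ℤ} → (∀ n → ∣ z n ⋆ ∣ ≤ 1ℚ) → ∀ r → Tame (λ N → ∑< N (λ k → z k /[1+ k ]^ r))
  Tame-harmonic {z} z≤1 r =
    Tame-resp (∑<-cong (λ k → *-identityʳ (z k /[1+ k ]^ r))) (Tame-series {z} {λ _ → 1ℚ} z≤1 r Tame-1)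

  Tame-harmonicFactor : ∀ {m} l (i : Vector ℕ⁺ m) j → Tame (λ n → harmonicFactor l i n j)
  Tame-harmonicFactor l i j with toℕ j ℕ.<ᵇ l
  ... | true  = Tame-harmonic {λ _ → ℤ.+ 1} (λ _ → ≤-refl) (i j)
  ... | false = Tame-harmonic {λ k → -1ℤ ℤ.^ k} (∣sign∣≤1 Sign.-) (i j)

  S-cauchy : ∀ {m} l (i : Vector ℕ⁺ m) q → IsCauchy (S-partial l i q)
  S-cauchy l i q = Cauchy-series-alt {λ k → -1ℤ ℤ.^ k} {λ k → ∏ (harmonicFactor l i (suc k))} (∣sign∣≤1 Sign.-) (λ _ → refl) q
    (Tame-suc (Tame-∏ (Tame-harmonicFactor l i)))

  Tame-ζ : ∀ w → Tame (ζ-partial w)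
  Tame-ζ []            = Tame-1
  Tame-ζ ((s , σ) ∷ w) = Tame-series {λ k → (σ ◃ 1) ℤ.^ suc k} {ζ-partial w} (λ n → ∣sign∣≤1 σ (suc n)) s (Tame-ζ w)

  ζ-cauchy : ∀ w → Admissible w → IsCauchy (ζ-partial (List⁺.toList w))
  ζ-cauchy ((s , Sign.-) ∷ w) adm =
    Cauchy-series-alt {λ k → -1ℤ ℤ.^ suc k} {ζ-partial w} (λ n → ∣sign∣≤1 Sign.- (suc n)) (λ _ → refl) s (Tame-ζ w)
  ζ-cauchy ((s , Sign.+) ∷ w) adm =
    Cauchy-series-abs {λ k → (Sign.+ ◃ 1) ℤ.^ suc k} {ζ-partial w} (λ n → ∣sign∣≤1 Sign.+ (suc n)) s (λ s≡1 → adm (s≡1 , refl)) (Tame-ζ w)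

open Convergence using (Cauchy-+; Cauchy-·; S-cauchy; ζ-cauchy)

S : ∀ {m} → ℕ → Vector ℕ⁺ m → ℕ⁺ → ℝ
S l i q = lim (S-partial l i q) (S-cauchy l i q)

ζ : (w : List⁺ Entry) → Admissible w → ℝ
ζ w adm = lim (ζ-partial (List⁺.toList w)) (ζ-cauchy w adm)

infixl 6 _⊕_
infixr 7 _·_

_⊕_ : ℝ → ℝ → ℝ
x ⊕ y = lim (λ n → seq x n + seq y n) (Cauchy-+ {seq x} {seq y} (cauchy x) (cauchy y))

_·_ : ℚ → ℝ → ℝ
r · x = lim (λ n → r * seq x n) (Cauchy-· {seq x} r (cauchy x))

0ℝ : ℝ
0ℝ = lim (λ _ → 0ℚ) (λ ε 0<ε → 0 , λ _ _ _ _ → 0<ε)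

∑ : ∀ {A : Set} → List A → (A → ℝ) → ℝ
∑ xs f = List.foldr (λ x y → f x ⊕ y) 0ℝ xs

infixr 5 ∑

syntax ∑ xs (λ x → e) = ∑[ x ∈ xs ] e

infixr 5 1+_∷_

data Composition : ℕ → Set where
  []     : Composition 0
  1+_∷_ : ∀ k {m} → Composition m → Composition (suc k ℕ.+ m)

enlargeHead : ∀ {m} → Composition (suc m) → Composition (suc (suc m))
enlargeHead (1+ k ∷ θ) = 1+ suc k ∷ θ

-- A composition of m + 2 either starts with the part 1, or arises from a
-- composition of m + 1 by enlarging its first part by 1.
compositions : ∀ m → List (Composition m)
compositions 0             = [] ∷ []
compositions 1             = (1+ 0 ∷ []) ∷ []
compositions (suc (suc m)) =
  List.map (1+ 0 ∷_) (compositions (suc m)) ++ List.map enlargeHead (compositions (suc m))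

∈-compositions : ∀ {m} (θ : Composition m) → θ ∈ compositions m
∈-compositions []                     = here refl
∈-compositions (1+ zero ∷ [])         = here refl
∈-compositions (1+ zero ∷ 1+ k ∷ θ)   = ∈-++⁺ˡ (∈-map⁺ (1+ 0 ∷_) (∈-compositions (1+ k ∷ θ)))
∈-compositions (1+ suc k ∷ θ)         =
  ∈-++⁺ʳ _ (∈-map⁺ enlargeHead (∈-compositions (1+ k ∷ θ)))

compositions-unique : ∀ m → Unique (compositions m)
compositions-unique 0             = [] ∷ []
compositions-unique 1             = [] ∷ []
compositions-unique (suc (suc m)) = Unique.++⁺
  (Unique.map⁺ (λ { refl → refl }) (compositions-unique (suc m)))
  (Unique.map⁺ enlargeHead-injective (compositions-unique (suc m)))
  disjoint
  where
  shrinkHead : ∀ {m n} → n ≡ suc (suc m) → Composition n → Composition (suc m)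
  shrinkHead eq (1+ zero ∷ θ)  = subst Composition (ℕ.suc-injective eq) θ
  shrinkHead eq (1+ suc k ∷ θ) = subst Composition (ℕ.suc-injective eq) (1+ k ∷ θ)
  shrink-enlarge : ∀ {m} (θ : Composition (suc m)) → shrinkHead refl (enlargeHead θ) ≡ θ
  shrink-enlarge (1+ k ∷ θ) = refl
  enlargeHead-injective : ∀ {m} {θ θ′ : Composition (suc m)} → enlargeHead θ ≡ enlargeHead θ′ → θ ≡ θ′
  enlargeHead-injective {θ = θ} {θ′} eq =
    trans (sym (shrink-enlarge θ)) (trans (cong (shrinkHead refl) eq) (shrink-enlarge θ′))
  1+0∷≢enlargeHead : ∀ {m} {θ : Composition (suc m)} θ′ → ¬ 1+ 0 ∷ θ ≡ enlargeHead θ′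
  1+0∷≢enlargeHead (1+ _ ∷ _) ()
  disjoint : ∀ {θ} → ¬ (θ ∈ List.map (1+ 0 ∷_) (compositions (suc m)) × θ ∈ List.map enlargeHead (compositions (suc m)))
  disjoint (∈₁ , ∈₂) =
    let _ , _ , eq₁ = ∈-map⁻ (1+ 0 ∷_) ∈₁
        θ′ , _ , eq₂ = ∈-map⁻ enlargeHead ∈₂
    in 1+0∷≢enlargeHead θ′ (trans (sym eq₁) eq₂)

permutations : ∀ m → List (Permutation′ m)
permutations zero    = Perm.id ∷ []
permutations (suc m) = cartesianProductWith (insert Fin.zero) (allFin (suc m)) (permutations m)

permutations-complete : ∀ {m} (π : Permutation′ m) → ∃[ ρ ] ρ ∈ permutations m × π Perm.≈ ρ
permutations-complete {zero}  π = Perm.id , here refl , λ ()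
permutations-complete {suc m} π =
  let ρ , ρ∈ , π≈ρ = permutations-complete (remove Fin.zero π)
      j = π ⟨$⟩ʳ Fin.zero
  in insert Fin.zero j ρ , ∈-cartesianProductWith⁺ (insert Fin.zero) (∈-allFin j) ρ∈ , λ where
       Fin.zero    → refl
       (Fin.suc k) → trans (sym (Perm.insert-remove Fin.zero π (Fin.suc k)))
         (trans (Perm.insert-punchIn Fin.zero j (remove Fin.zero π) k)
         (trans (cong (Fin.punchIn j) (π≈ρ k)) (sym (Perm.insert-punchIn Fin.zero j ρ k))))

length-permutations : ∀ m → List.length (permutations m) ≡ m !
length-permutations zero    = refl
length-permutations (suc m) = trans (length-product (allFin (suc m)))
  (cong₂ ℕ._*_ (length-tabulate {n = suc m} (λ j → j)) (length-permutations m))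
  where
  length-product : ∀ js → List.length (cartesianProductWith (insert Fin.zero) js (permutations m)) ≡
                          List.length js ℕ.* List.length (permutations m)
  length-product []       = refl
  length-product (j ∷ js) = trans (length-++ (List.map (insert Fin.zero j) (permutations m)))
    (cong₂ ℕ._+_ (length-map (insert Fin.zero j) (permutations m)) (length-product js))

firstBlock : ∀ {A : Set} k {m} → (Fin (suc k ℕ.+ m) → A) → List⁺ A
firstBlock k {m} f = List⁺.fromVec (Vec.tabulate (λ j → f (j ↑ˡ m)))

-- The values f(1),…,f(m) cut into consecutive blocks of lengths θ₁,…,θ_p: the
-- c-th block is f(θ₁+⋯+θ_{c-1}+1),…,f(θ₁+⋯+θ_c).
blocks : ∀ {A : Set} {m} → Composition m → (Fin m → A) → List (List⁺ A)
blocks []         f = []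
blocks (1+ k ∷ θ) f = firstBlock k f ∷ blocks θ (λ j → f (suc k ↑ʳ j))

blocks⁺ : ∀ {A : Set} {m} .{{_ : ℕ.NonZero m}} → Composition m → (Fin m → A) → List⁺ (List⁺ A)
blocks⁺ (1+ k ∷ θ) f = firstBlock k f ∷ blocks θ (λ j → f (suc k ↑ʳ j))

∏! : ∀ {m} → Composition m → ℕ
∏! []         = 1
∏! (1+ k ∷ θ) = suc k ! ℕ.* ∏! θ

∏!≢0 : ∀ {m} (θ : Composition m) → ℕ.NonZero (∏! θ)
∏!≢0 []         = _
∏!≢0 (1+ k ∷ θ) = ℕ.m*n≢0 (suc k !) (∏! θ) {{suc k ℕ.!≢0}} {{∏!≢0 θ}}

χℕ : ℤ → ℕ
χℕ ℤ.+[1+ _ ] = 1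
χℕ _          = 0

-- In λ#, blockSum, T̃ and Ť, b is a block ρ(θ₁+⋯+θ_{c-1}+1),…,ρ(θ₁+⋯+θ_c); so
-- λ# l b is λ_c, and blockSum i b is the sum of the i_{ρ(·)} over it.

λ# : ∀ {m} → ℕ → List⁺ (Fin m) → ℕ
λ# l b = sum (List.map (λ j → χℕ (ℤ.+ suc (toℕ j) ℤ.- ℤ.+ l)) (List⁺.toList b))

blockSum : ∀ {m} → Vector ℕ⁺ m → List⁺ (Fin m) → ℕ⁺
blockSum i b = List⁺.foldr₁ _+⁺_ (List⁺.map i b)

-- toSign sends even to + (no bar) and odd to - (bar); Ť has the opposite sign.
T̃ : ∀ {m} → ℕ → Vector ℕ⁺ m → List⁺ (Fin m) → Entry
T̃ l i b = blockSum i b , toSign (ℕ.parity (λ# l b))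

Ť : ∀ {m} → ℕ → Vector ℕ⁺ m → ℕ⁺ → List⁺ (Fin m) → Entry
Ť l i q b = q +⁺ blockSum i b , Sign.opposite (toSign (ℕ.parity (λ# l b)))

-- The strings (q̄ , T̃₁ , … , T̃_p) and (Ť₁ , T̃₂ , … , T̃_p).
q̄T̃ ŤT̃ : ∀ {m} → ℕ → Vector ℕ⁺ m → ℕ⁺ → List⁺ (List⁺ (Fin m)) → List⁺ Entry
q̄T̃ l i q (b ∷ bs) = (q , Sign.-) ∷ T̃ l i b ∷ List.map (T̃ l i) bs
ŤT̃ l i q (b ∷ bs) = Ť l i q b ∷ List.map (T̃ l i) bs

q̄T̃-admissible : ∀ {m} l (i : Vector ℕ⁺ m) q bs → Admissible (q̄T̃ l i q bs)
q̄T̃-admissible l i q (b ∷ bs) (_ , ())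

ŤT̃-admissible : ∀ {m} l (i : Vector ℕ⁺ m) q bs → Admissible (ŤT̃ l i q bs)
ŤT̃-admissible l i q (b ∷ bs) (≡1 , _) = q+s≢1 q (blockSum i b) ≡1
  where
  q+s≢1 : ∀ q s → ¬ value (q +⁺ s) ≡ 1
  q+s≢1 (mk⁺ (suc q)) (mk⁺ (suc s)) eq with trans (sym (ℕ.+-suc q s)) (ℕ.suc-injective eq)
  ... | ()

coefficient : ∀ {m} → ℕ → Composition m → List (List⁺ (Fin m)) → ℚ
coefficient l θ bs = ((-1ℤ ℤ.^ (sum (List.map (λ# l) bs) ℕ.+ 1)) / ∏! θ) {{∏!≢0 θ}}

{-# OPTIONS --safe #-}

-- The identity already holds between partial sums. Write S_j(n) = ∑_{k<n} x_j(k) for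
-- the harmonic factors. Expanding S_j(n+1) = S_j(n) + x_j(n) in ∏_j S_j over the set of
-- indices that contribute x_j(n), the product becomes a sum of strictly nested sums over
-- all ordered set partitions, and each of these arises from θ₁!⋯θ_p! pairs (θ , ρ). The
-- nested sums run over n₁ ≤ n, where n is the summation variable of S; the part n₁ < n
-- gives the first zeta value, and n₁ = n the second.
module Submission where

open import Defs
open import Data.Nat.Base as ℕ using (ℕ; zero; suc; _!; _≤_; _<_; NonZero)
import Data.Nat.Properties as ℕ
open import Data.Nat.ListAction using (sum)
open import Data.Integer.Base as ℤ using (ℤ; -1ℤ; _◃_)
import Data.Integer.Properties as ℤ
open import Data.Rational.Base as ℚ using (ℚ; 0ℚ; 1ℚ; _+_; _*_; _-_; -_; _/_; ∣_∣)
open import Data.Rational.Properties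
  using (+-identityˡ; +-inverseʳ; +-assoc; *-identityˡ; *-identityʳ; *-zeroˡ; *-zeroʳ; *-assoc; /-cong)
open import Data.Rational.Solver using (module +-*-Solver)
open import Data.Sign.Base as Sign using (Sign)
open import Data.Parity.Base using (toSign)
open import Data.Fin.Base as Fin using (Fin; toℕ; _↑ˡ_; _↑ʳ_; punchIn)
open import Data.Fin.Permutation as Perm using (Permutation′; _⟨$⟩ʳ_; insert)
open import Data.List.Base as List using (List; []; _∷_; _++_; allFin; cartesianProductWith)
open import Data.List.Properties using (map-tabulate)
open import Data.List.NonEmpty.Base as List⁺ using (List⁺; _∷_)
open import Data.Vec.Properties using (tabulate-cong)
open import Data.Vec.Functional using (Vector)
open import Data.Bool.Base using (true; false; if_then_else_)
open import Data.Product.Base using (_,_)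
open import Function.Base using (id; _∘_)
open import Relation.Binary.PropositionalEquality
open +-*-Solver using (solve; _:=_; _:+_; _:*_; :-_; con)
open Convergence using (_⋆; u; pow; u-step; /-homo; /-pow; pow-+; neg⋆; ∑<-cong; swap*)
open ≡-Reasoning

-- Finite sums and products of rationals.

∑<-+ : ∀ (f g : ℕ → ℚ) n → ∑< n (λ k → f k + g k) ≡ ∑< n f + ∑< n g
∑<-+ f g zero    = refl
∑<-+ f g (suc n) = trans (cong (_+ (f n + g n)) (∑<-+ f g n))
  (solve 4 (λ a b c d → (a :+ b) :+ (c :+ d) := (a :+ c) :+ (b :+ d)) refl (∑< n f) (∑< n g) (f n) (g n))

∑<-*ˡ : ∀ r (f : ℕ → ℚ) n → ∑< n (λ k → r * f k) ≡ r * ∑< n f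
∑<-*ˡ r f zero    = sym (*-zeroʳ r)
∑<-*ˡ r f (suc n) = trans (cong (_+ r * f n) (∑<-*ˡ r f n))
  (solve 3 (λ r a b → r :* a :+ r :* b := r :* (a :+ b)) refl r (∑< n f) (f n))

private
  variable
    A B C : Set

∑ₗ : List A → (A → ℚ) → ℚ
∑ₗ xs f = List.foldr (λ x y → f x + y) 0ℚ xs

∑ₗ-cong : ∀ {f g : A → ℚ} xs → (∀ x → f x ≡ g x) → ∑ₗ xs f ≡ ∑ₗ xs g
∑ₗ-cong []       f≗g = refl
∑ₗ-cong (x ∷ xs) f≗g = cong₂ _+_ (f≗g x) (∑ₗ-cong xs f≗g)

∑ₗ-0 : ∀ (xs : List A) → ∑ₗ xs (λ _ → 0ℚ) ≡ 0ℚ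
∑ₗ-0 []       = refl
∑ₗ-0 (x ∷ xs) = trans (+-identityˡ _) (∑ₗ-0 xs)

∑ₗ-+ : ∀ (f g : A → ℚ) xs → ∑ₗ xs (λ x → f x + g x) ≡ ∑ₗ xs f + ∑ₗ xs g
∑ₗ-+ f g []       = refl
∑ₗ-+ f g (x ∷ xs) = trans (cong ((f x + g x) +_) (∑ₗ-+ f g xs))
  (solve 4 (λ a b c d → (a :+ b) :+ (c :+ d) := (a :+ c) :+ (b :+ d)) refl (f x) (g x) (∑ₗ xs f) (∑ₗ xs g))

∑ₗ-*ˡ : ∀ r (f : A → ℚ) xs → ∑ₗ xs (λ x → r * f x) ≡ r * ∑ₗ xs f
∑ₗ-*ˡ r f []       = sym (*-zeroʳ r)
∑ₗ-*ˡ r f (x ∷ xs) = trans (cong (r * f x +_) (∑ₗ-*ˡ r f xs))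
  (solve 3 (λ r a b → r :* a :+ r :* b := r :* (a :+ b)) refl r (f x) (∑ₗ xs f))

∑ₗ-++ : ∀ (f : A → ℚ) xs ys → ∑ₗ (xs ++ ys) f ≡ ∑ₗ xs f + ∑ₗ ys f
∑ₗ-++ f []       ys = sym (+-identityˡ _)
∑ₗ-++ f (x ∷ xs) ys = trans (cong (f x +_) (∑ₗ-++ f xs ys)) (sym (+-assoc (f x) (∑ₗ xs f) (∑ₗ ys f)))

∑ₗ-map : ∀ (f : B → ℚ) (h : A → B) xs → ∑ₗ (List.map h xs) f ≡ ∑ₗ xs (f ∘ h)
∑ₗ-map f h []       = refl
∑ₗ-map f h (x ∷ xs) = cong (f (h x) +_) (∑ₗ-map f h xs)

∑ₗ-swap : ∀ (f : A → B → ℚ) xs ys →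
          ∑ₗ xs (λ x → ∑ₗ ys (f x)) ≡ ∑ₗ ys (λ y → ∑ₗ xs (λ x → f x y))
∑ₗ-swap f []       ys = sym (∑ₗ-0 ys)
∑ₗ-swap f (x ∷ xs) ys = trans (cong (∑ₗ ys (f x) +_) (∑ₗ-swap f xs ys))
  (sym (∑ₗ-+ (f x) (λ y → ∑ₗ xs (λ x → f x y)) ys))

∑ₗ-cartesianProductWith : ∀ (f : C → ℚ) (h : A → B → C) xs ys →
  ∑ₗ (cartesianProductWith h xs ys) f ≡ ∑ₗ xs (λ x → ∑ₗ ys (λ y → f (h x y)))
∑ₗ-cartesianProductWith f h []       ys = refl
∑ₗ-cartesianProductWith f h (x ∷ xs) ys =
  trans (∑ₗ-++ f (List.map (h x) ys) (cartesianProductWith h xs ys))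
        (cong₂ _+_ (∑ₗ-map f (h x) ys) (∑ₗ-cartesianProductWith f h xs ys))

∑ₗ-allFin-suc : ∀ {m} (f : Fin (suc m) → ℚ) →
  ∑ₗ (allFin (suc m)) f ≡ f Fin.zero + ∑ₗ (allFin m) (f ∘ Fin.suc)
∑ₗ-allFin-suc {m} f = cong (f Fin.zero +_)
  (trans (cong (λ js → ∑ₗ js f) (sym (map-tabulate {n = m} id Fin.suc)))
         (∑ₗ-map f Fin.suc (allFin m)))

∑<-∑ₗ : ∀ (f : ℕ → A → ℚ) xs n → ∑< n (λ k → ∑ₗ xs (f k)) ≡ ∑ₗ xs (λ x → ∑< n (λ k → f k x))
∑<-∑ₗ f xs zero    = sym (∑ₗ-0 xs)
∑<-∑ₗ f xs (suc n) = trans (cong (_+ ∑ₗ xs (f n)) (∑<-∑ₗ f xs n))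
  (sym (∑ₗ-+ (λ x → ∑< n (λ k → f k x)) (f n) xs))

∏-cong : ∀ {m} {f g : Vector ℚ m} → (∀ j → f j ≡ g j) → ∏ f ≡ ∏ g
∏-cong {zero}  f≗g = refl
∏-cong {suc m} f≗g = cong₂ _*_ (f≗g Fin.zero) (∏-cong (f≗g ∘ Fin.suc))

-- The list is made of the `insert Fin.zero j ρ`, which send `Fin.zero` to `j` and act on the rest
-- as `punchIn j` after `ρ`. This description holds only pointwise, hence the congruence hypothesis
-- on `h`.
∑ₗ-permutations-suc : ∀ {m} (h : A → (Fin m → A) → ℚ) →
  (∀ a {f g} → (∀ j → f j ≡ g j) → h a f ≡ h a g) → ∀ (v : Fin (suc m) → A) →
  ∑ₗ (permutations (suc m)) (λ ρ → h (v (ρ ⟨$⟩ʳ Fin.zero)) (λ j → v (ρ ⟨$⟩ʳ Fin.suc j))) ≡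
  ∑ₗ (allFin (suc m)) (λ j → ∑ₗ (permutations m) (λ ρ → h (v j) (λ k → v (punchIn j (ρ ⟨$⟩ʳ k)))))
∑ₗ-permutations-suc {m = m} h h-cong v =
  trans (∑ₗ-cartesianProductWith
          (λ ρ → h (v (ρ ⟨$⟩ʳ Fin.zero)) (λ j → v (ρ ⟨$⟩ʳ Fin.suc j)))
          (insert Fin.zero) (allFin (suc m)) (permutations m))
        (∑ₗ-cong (allFin (suc m)) λ j → ∑ₗ-cong (permutations m) λ ρ →
          h-cong (v j) (λ k → cong v (Perm.insert-punchIn Fin.zero j ρ k)))

-- Factorials and their inverses in ℚ.

fromℕ : ℕ → ℚ
fromℕ zero    = 0ℚ
fromℕ (suc n) = 1ℚ + fromℕ n

-- The induction rests on `u-step`, that is 1/(k+1) = 1/(k+2) + 1/((k+1)(k+2)).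
fromℕ-u : ∀ k → fromℕ (suc k) * u k ≡ 1ℚ
fromℕ-u zero    = refl
fromℕ-u (suc k) = begin
  (1ℚ + x) * u (suc k)                ≡⟨ solve 2 (λ x v → (con 1ℚ :+ x) :* v := v :+ x :* v) refl x (u (suc k)) ⟩
  u (suc k) + x * u (suc k)           ≡⟨ cong (_+ x * u (suc k)) (sym (*-identityˡ (u (suc k)))) ⟩
  1ℚ * u (suc k) + x * u (suc k)      ≡⟨ cong (λ y → y * u (suc k) + x * u (suc k)) (sym (fromℕ-u k)) ⟩
  x * u k * u (suc k) + x * u (suc k) ≡⟨ solve 3 (λ x y z → x :* y :* z :+ x :* z := x :* (z :+ y :* z)) refl x (u k) (u (suc k)) ⟩
  x * (u (suc k) + u k * u (suc k))   ≡⟨ cong (x *_) (sym (u-step k)) ⟩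
  x * u k                             ≡⟨ fromℕ-u k ⟩
  1ℚ ∎
  where x = fromℕ (suc k)

fact invFact : ℕ → ℚ
fact zero       = 1ℚ
fact (suc n)    = fromℕ (suc n) * fact n
invFact zero    = 1ℚ
invFact (suc n) = u n * invFact n

fact-invFact : ∀ n → fact n * invFact n ≡ 1ℚ
fact-invFact zero    = refl
fact-invFact (suc n) = begin
  x * fact n * (u n * invFact n)   ≡⟨ solve 4 (λ a b c d → a :* b :* (c :* d) := (a :* c) :* (b :* d)) refl x (fact n) (u n) (invFact n) ⟩
  (x * u n) * (fact n * invFact n) ≡⟨ cong₂ _*_ (fromℕ-u n) (fact-invFact n) ⟩
  1ℚ * 1ℚ                          ≡⟨⟩
  1ℚ ∎
  where x = fromℕ (suc n)

1/!≡invFact : ∀ n .{{_ : NonZero (n !)}} → ℤ.+ 1 / (n !) ≡ invFact n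
1/!≡invFact zero    = refl
1/!≡invFact (suc n) = trans (/-homo (ℤ.+ 1) (ℤ.+ 1) (suc n) (n !)) (cong (u n *_) (1/!≡invFact n))
  where
  instance
    n!≢0 : NonZero (n !)
    n!≢0 = n ℕ.!≢0

-- Generating polynomials and linear functionals on their coefficients.

δ₀ : ℕ → ℚ
δ₀ zero    = 1ℚ
δ₀ (suc k) = 0ℚ

-- Adjoint of differentiation: pairing `c` with the coefficients of the derivative of a polynomial
-- is pairing `D c` with those of the polynomial.
D : (ℕ → ℚ) → ℕ → ℚ
D c zero    = 0ℚ
D c (suc k) = fromℕ (suc k) * c k

-- The factor 1ℚ gives the right side the shape that `umbral-linear` accepts.
D-suc : ∀ c k → D c (suc k) ≡ 1ℚ * c k + D (c ∘ suc) k
D-suc c zero    = solve 1 (λ x → (con 1ℚ :+ con 0ℚ) :* x := con 1ℚ :* x :+ con 0ℚ) refl (c 0)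
D-suc c (suc k) = solve 2 (λ n x → (con 1ℚ :+ n) :* x := con 1ℚ :* x :+ n :* x) refl (fromℕ (suc k)) (c (suc k))

-- The k letters of a first block can be listed in k! orders.
κ : (ℕ → ℚ) → ℕ → ℚ
κ c zero    = 0ℚ
κ c (suc k) = fact (suc k) * c k

-- A block of one letter contributes `c 0`, at k = 1 only. A longer block has k choices for its
-- first letter and then (k-1)! orders of the others, with `c` shifted by one.
κ-step : ∀ c k → κ c k ≡ c 0 * D δ₀ k + D (κ (c ∘ suc)) k
κ-step c zero          = solve 1 (λ x → con 0ℚ := x :* con 0ℚ :+ con 0ℚ) refl (c 0)
κ-step c (suc zero)    = solve 1 (λ x → con 1ℚ :* x := x :* con 1ℚ :+ con 0ℚ) refl (c 0)
κ-step c (suc (suc k)) =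
  solve 4 (λ n f x y → (n :* f) :* x := y :* (n :* con 0ℚ) :+ n :* (f :* x)) refl
    (fromℕ (suc (suc k))) (fact (suc k)) (c (suc k)) (c 0)

-- If ∏_j (s j + z a j) = ∑_k e_k z^k over the letters v, then umbral c v = ∑_k c_k e_k.
module Umbral {A : Set} (s a : A → ℚ) where

  umbral : (ℕ → ℚ) → ∀ {m} → (Fin m → A) → ℚ
  umbral c {zero}  v = c 0
  umbral c {suc m} v = s (v Fin.zero) * umbral c (v ∘ Fin.suc)
                     + a (v Fin.zero) * umbral (c ∘ suc) (v ∘ Fin.suc)

  umbral-cong : ∀ {c d} → (∀ k → c k ≡ d k) → ∀ {m} (v : Fin m → A) → umbral c v ≡ umbral d v
  umbral-cong c≗d {zero}  v = c≗d 0
  umbral-cong c≗d {suc m} v = cong₂ (λ x y → s (v Fin.zero) * x + a (v Fin.zero) * y)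
    (umbral-cong c≗d (v ∘ Fin.suc)) (umbral-cong (c≗d ∘ suc) (v ∘ Fin.suc))

  umbral-linear : ∀ r c d {m} (v : Fin m → A) →
                  umbral (λ k → r * c k + d k) v ≡ r * umbral c v + umbral d v
  umbral-linear r c d {zero}  v = refl
  umbral-linear r c d {suc m} v = trans
    (cong₂ (λ x y → s v₀ * x + a v₀ * y) (umbral-linear r c d v′) (umbral-linear r (c ∘ suc) (d ∘ suc) v′))
    (solve 7 (λ s a r x y x′ y′ → s :* (r :* x :+ y) :+ a :* (r :* x′ :+ y′) :=
                r :* (s :* x :+ a :* x′) :+ (s :* y :+ a :* y′))
       refl (s v₀) (a v₀) r (umbral c v′) (umbral d v′) (umbral (c ∘ suc) v′) (umbral (d ∘ suc) v′))
    where
    v₀ = v Fin.zero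
    v′ = v ∘ Fin.suc

  umbral-0 : ∀ {m} (v : Fin m → A) → umbral (λ _ → 0ℚ) v ≡ 0ℚ
  umbral-0 {zero}  v = refl
  umbral-0 {suc m} v = trans (cong (λ x → s (v Fin.zero) * x + a (v Fin.zero) * x) (umbral-0 (v ∘ Fin.suc)))
    (solve 2 (λ s a → s :* con 0ℚ :+ a :* con 0ℚ := con 0ℚ) refl (s (v Fin.zero)) (a (v Fin.zero)))

  -- Evaluation of the generating polynomial at z = 1.
  umbral-1 : ∀ {m} (v : Fin m → A) → umbral (λ _ → 1ℚ) v ≡ ∏ (λ j → s (v j) + a (v j))
  umbral-1 {zero}  v = refl
  umbral-1 {suc m} v = trans (cong (λ x → s (v Fin.zero) * x + a (v Fin.zero) * x) (umbral-1 (v ∘ Fin.suc)))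
    (solve 3 (λ s a x → s :* x :+ a :* x := (s :+ a) :* x) refl (s (v Fin.zero)) (a (v Fin.zero)) _)

  -- Evaluation of the generating polynomial at z = 0.
  umbral-δ₀ : ∀ {m} (v : Fin m → A) → umbral δ₀ v ≡ ∏ (s ∘ v)
  umbral-δ₀ {zero}  v = refl
  umbral-δ₀ {suc m} v = trans
    (cong₂ (λ x y → s (v Fin.zero) * x + a (v Fin.zero) * y) (umbral-δ₀ (v ∘ Fin.suc)) (umbral-0 (v ∘ Fin.suc)))
    (solve 3 (λ s a x → s :* x :+ a :* con 0ℚ := s :* x) refl (s (v Fin.zero)) (a (v Fin.zero)) _)

  -- The derivative of ∏_j (s j + z a j) is the sum over j of a j times the product without j.
  umbral-remove : ∀ c {m} (v : Fin (suc m) → A) →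
    ∑ₗ (allFin (suc m)) (λ j → a (v j) * umbral c (v ∘ punchIn j)) ≡ umbral (D c) v
  umbral-remove c {zero} v =
    solve 3 (λ s a x → a :* x :+ con 0ℚ := s :* con 0ℚ :+ a :* ((con 1ℚ :+ con 0ℚ) :* x))
      refl (s (v Fin.zero)) (a (v Fin.zero)) (c 0)
  umbral-remove c {suc m} v = begin
    ∑ₗ (allFin (suc (suc m))) (λ j → a (v j) * umbral c (v ∘ punchIn j))
      ≡⟨ ∑ₗ-allFin-suc (λ j → a (v j) * umbral c (v ∘ punchIn j)) ⟩
    -- When a later letter is removed, `v Fin.zero` stays in front, so `umbral` unfolds once with
    -- `s₀` and `a₀`.
    a₀ * umbral c v′ + ∑ₗ js (λ j → a (v′ j) * (s₀ * X j + a₀ * Y j))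
      ≡⟨ cong (a₀ * umbral c v′ +_) (∑ₗ-cong js λ j →
           solve 5 (λ b s a x y → b :* (s :* x :+ a :* y) := s :* (b :* x) :+ a :* (b :* y)) refl (a (v′ j)) s₀ a₀ (X j) (Y j)) ⟩
    a₀ * umbral c v′ + ∑ₗ js (λ j → s₀ * (a (v′ j) * X j) + a₀ * (a (v′ j) * Y j))
      ≡⟨ cong (a₀ * umbral c v′ +_) (∑ₗ-+ (λ j → s₀ * (a (v′ j) * X j)) (λ j → a₀ * (a (v′ j) * Y j)) js) ⟩
    a₀ * umbral c v′ + (∑ₗ js (λ j → s₀ * (a (v′ j) * X j)) + ∑ₗ js (λ j → a₀ * (a (v′ j) * Y j)))
      ≡⟨ cong (a₀ * umbral c v′ +_) (cong₂ _+_
           (trans (∑ₗ-*ˡ s₀ (λ j → a (v′ j) * X j) js) (cong (s₀ *_) (umbral-remove c v′)))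
           (trans (∑ₗ-*ˡ a₀ (λ j → a (v′ j) * Y j) js) (cong (a₀ *_) (umbral-remove (c ∘ suc) v′)))) ⟩
    a₀ * umbral c v′ + (s₀ * umbral (D c) v′ + a₀ * umbral (D (c ∘ suc)) v′)
      ≡⟨ solve 5 (λ a s x y z → a :* x :+ (s :* y :+ a :* z) := s :* y :+ a :* (con 1ℚ :* x :+ z))
           refl a₀ s₀ (umbral c v′) (umbral (D c) v′) (umbral (D (c ∘ suc)) v′) ⟩
    s₀ * umbral (D c) v′ + a₀ * (1ℚ * umbral c v′ + umbral (D (c ∘ suc)) v′)
      ≡⟨ cong (λ x → s₀ * umbral (D c) v′ + a₀ * x)
           (trans (sym (umbral-linear 1ℚ c (D (c ∘ suc)) v′)) (umbral-cong (λ k → sym (D-suc c k)) v′)) ⟩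
    s₀ * umbral (D c) v′ + a₀ * umbral (D c ∘ suc) v′ ∎
    where
    js = allFin (suc m)
    v′ = v ∘ Fin.suc
    s₀ = s (v Fin.zero)
    a₀ = a (v Fin.zero)
    X Y : Fin (suc m) → ℚ
    X j = umbral c (v′ ∘ punchIn j)
    Y j = umbral (c ∘ suc) (v′ ∘ punchIn j)

-- Weights and blocks of compositions.

weight : ∀ {m} → Composition m → ℚ
weight θ = (ℤ.+ 1 / ∏! θ) {{∏!≢0 θ}}

weight-∷ : ∀ k {m} (θ : Composition m) → weight (1+ k ∷ θ) ≡ invFact (suc k) * weight θ
weight-∷ k θ = trans
  (/-homo (ℤ.+ 1) (ℤ.+ 1) (suc k !) (∏! θ) {{suc k ℕ.!≢0}} {{∏!≢0 θ}} {{∏!≢0 (1+ k ∷ θ)}})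
  (cong (_* weight θ) (1/!≡invFact (suc k) {{suc k ℕ.!≢0}}))

firstBlock-cong : ∀ k {m} {f g : Fin (suc k ℕ.+ m) → A} → (∀ j → f j ≡ g j) → firstBlock k f ≡ firstBlock k g
firstBlock-cong k {m} f≗g = cong List⁺.fromVec (tabulate-cong (λ j → f≗g (j ↑ˡ m)))

blocks-cong : ∀ {m} (θ : Composition m) {f g : Fin m → A} → (∀ j → f j ≡ g j) → blocks θ f ≡ blocks θ g
blocks-cong []         f≗g = refl
blocks-cong (1+ k ∷ θ) f≗g = cong₂ _∷_ (firstBlock-cong k f≗g) (blocks-cong θ (λ j → f≗g (suc k ↑ʳ j)))

-- Products of sums as strictly nested sums.

module Expansion {A : Set} (x : A → ℕ → ℚ) where

  blockTerm : List⁺ A → ℕ → ℚ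
  blockTerm b k = List⁺.foldr₁ _*_ (List⁺.map (λ a → x a k) b)

  nestedSum : List (List⁺ A) → ℕ → ℚ
  nestedSum []       n = 1ℚ
  nestedSum (b ∷ bs) n = ∑< n λ k → blockTerm b k * nestedSum bs k

  -- The word `v` is arbitrary so that deleting its `j`-th letter leads back to the same function,
  -- at `v ∘ punchIn j`.
  expansion : ∀ {m} → (Fin m → A) → ℕ → ℚ
  expansion {m} v n = ∑ₗ (compositions m) λ θ → ∑ₗ (permutations m) λ ρ →
    weight θ * nestedSum (blocks θ (v ∘ (ρ ⟨$⟩ʳ_))) n

  -- With c k = 1/(k+1)!, the increment of the summand of expansion from n to n + 1. The
  -- sequence c is kept free since enlarging the head of θ shifts it.
  increment : (ℕ → ℚ) → ∀ {m} → Composition (suc m) → (Fin (suc m) → A) → ℕ → ℚ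
  increment c (1+ k ∷ θ) f n =
    c k * (weight θ * (blockTerm (firstBlock k f) n * nestedSum (blocks θ (λ j → f (suc k ↑ʳ j))) n))

  increment-cong : ∀ c {m} (θ : Composition (suc m)) n {f g} → (∀ j → f j ≡ g j) →
                   increment c θ f n ≡ increment c θ g n
  increment-cong c (1+ k ∷ θ) n f≗g = cong₂ (λ b bs → c k * (weight θ * (blockTerm b n * nestedSum bs n)))
    (firstBlock-cong k f≗g) (blocks-cong θ (λ j → f≗g (suc k ↑ʳ j)))

  -- The factor of the first letter leaves the block. The weight inside `increment` ignores the head
  -- of the composition, so only `c` has to be shifted.
  increment-enlargeHead : ∀ c {m} (θ : Composition (suc m)) f n →
    increment c (enlargeHead θ) f n ≡ x (f Fin.zero) n * increment (c ∘ suc) θ (f ∘ Fin.suc) n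
  increment-enlargeHead c (1+ k ∷ θ) f n =
    solve 5 (λ c w x b z → c :* (w :* ((x :* b) :* z)) := x :* (c :* (w :* (b :* z)))) refl
      (c (suc k)) (weight θ) (x (f Fin.zero) n) (blockTerm (firstBlock k (f ∘ Fin.suc)) n)
      (nestedSum (blocks θ (λ j → f (suc (suc k) ↑ʳ j))) n)

  -- Only the outermost sum gains a term, at `n`; by `weight-∷` its weight is that of the tail times
  -- 1/(k+1)!.
  nestedSum-suc : ∀ {m} (θ : Composition (suc m)) f n →
    weight θ * nestedSum (blocks θ f) (suc n) ≡
    weight θ * nestedSum (blocks θ f) n + increment (invFact ∘ suc) θ f n
  nestedSum-suc (1+ k ∷ θ) f n = trans
    (solve 3 (λ w z y → w :* (z :+ y) := w :* z :+ w :* y) refl w (nestedSum (blocks (1+ k ∷ θ) f) n) y)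
    (cong (w * nestedSum (blocks (1+ k ∷ θ) f) n +_)
      (trans (cong (_* y) (weight-∷ k θ)) (*-assoc (invFact (suc k)) (weight θ) y)))
    where
    w = weight (1+ k ∷ θ)
    y = blockTerm (firstBlock k f) n * nestedSum (blocks θ (λ j → f (suc k ↑ʳ j))) n

  totalIncrement : (ℕ → ℚ) → ∀ {m} → (Fin (suc m) → A) → ℕ → ℚ
  totalIncrement c {m} v n = ∑ₗ (compositions (suc m)) λ θ → ∑ₗ (permutations (suc m)) λ ρ →
    increment c θ (v ∘ (ρ ⟨$⟩ʳ_)) n

  expansion-suc : ∀ {m} (v : Fin (suc m) → A) n →
    expansion v (suc n) ≡ expansion v n + totalIncrement (invFact ∘ suc) v n
  expansion-suc {m} v n = trans
    (∑ₗ-cong θs λ θ → trans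
      (∑ₗ-cong ρs (λ ρ → nestedSum-suc θ (v ∘ (ρ ⟨$⟩ʳ_)) n))
      (∑ₗ-+ (λ ρ → weight θ * nestedSum (blocks θ (v ∘ (ρ ⟨$⟩ʳ_))) n)
            (λ ρ → increment (invFact ∘ suc) θ (v ∘ (ρ ⟨$⟩ʳ_)) n) ρs))
    (∑ₗ-+ (λ θ → ∑ₗ ρs λ ρ → weight θ * nestedSum (blocks θ (v ∘ (ρ ⟨$⟩ʳ_))) n)
          (λ θ → ∑ₗ ρs λ ρ → increment (invFact ∘ suc) θ (v ∘ (ρ ⟨$⟩ʳ_)) n) θs)
    where
    θs = compositions (suc m)
    ρs = permutations (suc m)

  -- Permutations are grouped by the letter they put first. `cs` and `h` are abstract to serve two
  -- cases: a head block of one letter, and an enlarged head block.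
  ∑-head : ∀ {C : Set} {m} (cs : List C) (h : C → (Fin m → A) → ℚ) →
    (∀ θ {f g} → (∀ j → f j ≡ g j) → h θ f ≡ h θ g) → ∀ (v : Fin (suc m) → A) n →
    ∑ₗ cs (λ θ → ∑ₗ (permutations (suc m)) (λ ρ →
      x (v (ρ ⟨$⟩ʳ Fin.zero)) n * h θ (λ j → v (ρ ⟨$⟩ʳ Fin.suc j)))) ≡
    ∑ₗ (allFin (suc m)) (λ j → x (v j) n *
      ∑ₗ cs (λ θ → ∑ₗ (permutations m) (λ ρ → h θ (v ∘ punchIn j ∘ (ρ ⟨$⟩ʳ_)))))
  ∑-head {m = m} cs h h-cong v n = begin
    ∑ₗ cs (λ θ → ∑ₗ (permutations (suc m)) (λ ρ →
      x (v (ρ ⟨$⟩ʳ Fin.zero)) n * h θ (λ j → v (ρ ⟨$⟩ʳ Fin.suc j))))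
      ≡⟨ ∑ₗ-cong cs (λ θ → ∑ₗ-permutations-suc (λ a f → x a n * h θ f) (λ a f≗g → cong (x a n *_) (h-cong θ f≗g)) v) ⟩
    ∑ₗ cs (λ θ → ∑ₗ js (λ j → ∑ₗ (permutations m) (λ ρ → x (v j) n * y θ j ρ)))
      ≡⟨ ∑ₗ-swap (λ θ j → ∑ₗ (permutations m) (λ ρ → x (v j) n * y θ j ρ)) cs js ⟩
    ∑ₗ js (λ j → ∑ₗ cs (λ θ → ∑ₗ (permutations m) (λ ρ → x (v j) n * y θ j ρ)))
      ≡⟨ ∑ₗ-cong js (λ j → trans
           (∑ₗ-cong cs (λ θ → ∑ₗ-*ˡ (x (v j) n) (y θ j) (permutations m)))
           (∑ₗ-*ˡ (x (v j) n) (λ θ → ∑ₗ (permutations m) (y θ j)) cs)) ⟩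
    ∑ₗ js (λ j → x (v j) n * ∑ₗ cs (λ θ → ∑ₗ (permutations m) (y θ j))) ∎
    where
    js = allFin (suc m)
    y = λ θ j (ρ : Permutation′ m) → h θ (v ∘ punchIn j ∘ (ρ ⟨$⟩ʳ_))

  -- Once the one-letter head block is fixed, the remaining letters are partitioned and ordered
  -- freely, which is their own `expansion`.
  ∑-singletonHead : ∀ c {m} (v : Fin (suc m) → A) n →
    ∑ₗ (List.map (1+ 0 ∷_) (compositions m)) (λ θ → ∑ₗ (permutations (suc m)) λ ρ → increment c θ (v ∘ (ρ ⟨$⟩ʳ_)) n) ≡
    c 0 * ∑ₗ (allFin (suc m)) (λ j → x (v j) n * expansion (v ∘ punchIn j) n)
  ∑-singletonHead c {m} v n = begin
    ∑ₗ (List.map (1+ 0 ∷_) θs) (λ θ → ∑ₗ ρs λ ρ → increment c θ (v ∘ (ρ ⟨$⟩ʳ_)) n)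
      ≡⟨ ∑ₗ-map (λ θ → ∑ₗ ρs λ ρ → increment c θ (v ∘ (ρ ⟨$⟩ʳ_)) n) (1+ 0 ∷_) θs ⟩
    ∑ₗ θs (λ θ → ∑ₗ ρs λ ρ → increment c (1+ 0 ∷ θ) (v ∘ (ρ ⟨$⟩ʳ_)) n)
      ≡⟨ ∑ₗ-cong θs (λ θ → trans
           (∑ₗ-cong ρs (λ ρ → cong (c 0 *_) (swap* (weight θ) (x (v (ρ ⟨$⟩ʳ Fin.zero)) n) _)))
           (∑ₗ-*ˡ (c 0) (λ ρ → x (v (ρ ⟨$⟩ʳ Fin.zero)) n * h θ (λ j → v (ρ ⟨$⟩ʳ Fin.suc j))) ρs)) ⟩
    ∑ₗ θs (λ θ → c 0 * ∑ₗ ρs (λ ρ → x (v (ρ ⟨$⟩ʳ Fin.zero)) n * h θ (λ j → v (ρ ⟨$⟩ʳ Fin.suc j))))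
      ≡⟨ ∑ₗ-*ˡ (c 0) (λ θ → ∑ₗ ρs (λ ρ → x (v (ρ ⟨$⟩ʳ Fin.zero)) n * h θ (λ j → v (ρ ⟨$⟩ʳ Fin.suc j)))) θs ⟩
    c 0 * ∑ₗ θs (λ θ → ∑ₗ ρs (λ ρ → x (v (ρ ⟨$⟩ʳ Fin.zero)) n * h θ (λ j → v (ρ ⟨$⟩ʳ Fin.suc j))))
      ≡⟨ cong (c 0 *_) (∑-head θs h (λ θ f≗g → cong (λ bs → weight θ * nestedSum bs n) (blocks-cong θ f≗g)) v n) ⟩
    c 0 * ∑ₗ (allFin (suc m)) (λ j → x (v j) n * expansion (v ∘ punchIn j) n) ∎
    where
    θs = compositions m
    ρs = permutations (suc m)
    h : Composition m → (Fin m → A) → ℚ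
    h θ f = weight θ * nestedSum (blocks θ f) n

  -- The two terms follow the two ways in which `compositions` builds its list: a head equal to 1,
  -- or an enlarged head.
  totalIncrement-suc : ∀ c {m} (v : Fin (suc (suc m)) → A) n →
    totalIncrement c v n ≡
    c 0 * ∑ₗ (allFin (suc (suc m))) (λ j → x (v j) n * expansion (v ∘ punchIn j) n) +
    ∑ₗ (allFin (suc (suc m))) (λ j → x (v j) n * totalIncrement (c ∘ suc) (v ∘ punchIn j) n)
  totalIncrement-suc c {m} v n = trans
    (∑ₗ-++ F (List.map (1+ 0 ∷_) θs) (List.map enlargeHead θs))
    (cong₂ _+_ (∑-singletonHead c v n)
      (trans (∑ₗ-map F enlargeHead θs)
      (trans (∑ₗ-cong θs λ θ → ∑ₗ-cong ρs λ ρ → increment-enlargeHead c θ (v ∘ (ρ ⟨$⟩ʳ_)) n)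
             (∑-head θs (λ θ f → increment (c ∘ suc) θ f n) (λ θ → increment-cong (c ∘ suc) θ n) v n))))
    where
    θs = compositions (suc m)
    ρs = permutations (suc (suc m))
    F : Composition (suc (suc m)) → ℚ
    F θ = ∑ₗ ρs λ ρ → increment c θ (v ∘ (ρ ⟨$⟩ʳ_)) n

  module _ (n : ℕ) where

    -- The polynomial is ∏_j (S_j(n) + z x_j(n)); its k-th coefficient collects the choices of k
    -- letters that contribute their new term.
    open Umbral (λ a → ∑< n (x a)) (λ a → x a n)

    -- The induction hypothesis on `n`, for words of every length.
    module _ (expansion≡ : ∀ {m} (v : Fin m → A) → expansion v n ≡ ∏ (λ j → ∑< n (x (v j)))) where

      ∑-remove-expansion : ∀ {m} (v : Fin (suc m) → A) →
        ∑ₗ (allFin (suc m)) (λ j → x (v j) n * expansion (v ∘ punchIn j) n) ≡ umbral (D δ₀) v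
      ∑-remove-expansion {m} v = trans
        (∑ₗ-cong (allFin (suc m)) λ j → cong (x (v j) n *_)
          (trans (expansion≡ (v ∘ punchIn j)) (sym (umbral-δ₀ (v ∘ punchIn j)))))
        (umbral-remove δ₀ v)

      -- Each set of k letters forms the first block in k! orders, each with coefficient c_{k-1},
      -- and the other letters give the product of their S_j(n). The recursion on the first letter
      -- shifts `c`, so `c` must be general.
      totalIncrement≡ : ∀ c {m} (v : Fin (suc m) → A) → totalIncrement c v n ≡ umbral (κ c) v
      -- The only composition of 1 has head 1, so there is no enlarged-head term.
      totalIncrement≡ c {zero}  v = trans (∑-singletonHead c v n)
        (trans (cong (c 0 *_) (∑-remove-expansion v))
          (solve 3 (λ s a c → c :* (s :* con 0ℚ :+ a :* con 1ℚ) := s :* con 0ℚ :+ a :* (con 1ℚ :* c)) refl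
            (∑< n (x (v Fin.zero))) (x (v Fin.zero) n) (c 0)))
      totalIncrement≡ c {suc m} v = begin
        totalIncrement c v n
          ≡⟨ totalIncrement-suc c v n ⟩
        c 0 * ∑ₗ js (λ j → x (v j) n * expansion (v ∘ punchIn j) n) +
        ∑ₗ js (λ j → x (v j) n * totalIncrement (c ∘ suc) (v ∘ punchIn j) n)
          ≡⟨ cong₂ (λ y z → c 0 * y + z) (∑-remove-expansion v) (trans
               (∑ₗ-cong js (λ j → cong (x (v j) n *_) (totalIncrement≡ (c ∘ suc) (v ∘ punchIn j))))
               (umbral-remove (κ (c ∘ suc)) v)) ⟩
        c 0 * umbral (D δ₀) v + umbral (D (κ (c ∘ suc))) v
          ≡⟨ sym (umbral-linear (c 0) (D δ₀) (D (κ (c ∘ suc))) v) ⟩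
        umbral (λ k → c 0 * D δ₀ k + D (κ (c ∘ suc)) k) v
          ≡⟨ umbral-cong (λ k → sym (κ-step c k)) v ⟩
        umbral (κ c) v ∎
        where js = allFin (suc (suc m))

      -- The denominators k! cancel the k! orders of the first block, so all coefficients become 1
      -- and the polynomial is evaluated at z = 1.
      expansion-suc≡ : ∀ {m} (v : Fin m → A) → expansion v (suc n) ≡ ∏ (λ j → ∑< (suc n) (x (v j)))
      expansion-suc≡ {zero}  v = refl
      expansion-suc≡ {suc m} v = begin
        expansion v (suc n)
          ≡⟨ expansion-suc v n ⟩
        expansion v n + totalIncrement (invFact ∘ suc) v n
          ≡⟨ cong₂ _+_ (trans (expansion≡ v) (sym (umbral-δ₀ v))) (totalIncrement≡ (invFact ∘ suc) v) ⟩
        umbral δ₀ v + umbral (κ (invFact ∘ suc)) v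
          ≡⟨ cong (_+ umbral (κ (invFact ∘ suc)) v) (sym (*-identityˡ (umbral δ₀ v))) ⟩
        1ℚ * umbral δ₀ v + umbral (κ (invFact ∘ suc)) v
          ≡⟨ sym (umbral-linear 1ℚ δ₀ (κ (invFact ∘ suc)) v) ⟩
        umbral (λ k → 1ℚ * δ₀ k + κ (invFact ∘ suc) k) v
          ≡⟨ umbral-cong (λ { zero → refl ; (suc k) → cong (0ℚ +_) (fact-invFact (suc k)) }) v ⟩
        umbral (λ _ → 1ℚ) v
          ≡⟨ umbral-1 v ⟩
        ∏ (λ j → ∑< (suc n) (x (v j))) ∎

  -- For a nonempty word every outermost sum is empty; for the empty word both sides are 1.
  expansion-0 : ∀ {m} (v : Fin m → A) → expansion v 0 ≡ ∏ {m} (λ _ → 0ℚ)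
  expansion-0 {zero}  v = refl
  expansion-0 {suc m} v = begin
    expansion v 0                    ≡⟨ ∑ₗ-cong (compositions (suc m)) (λ θ →
                                          trans (∑ₗ-cong (permutations (suc m)) (λ ρ → vanish θ (v ∘ (ρ ⟨$⟩ʳ_))))
                                                (∑ₗ-0 (permutations (suc m)))) ⟩
    ∑ₗ (compositions (suc m)) (λ _ → 0ℚ) ≡⟨ ∑ₗ-0 (compositions (suc m)) ⟩
    0ℚ                               ≡⟨ sym (*-zeroˡ (∏ {m} (λ _ → 0ℚ))) ⟩
    0ℚ * ∏ {m} (λ _ → 0ℚ) ∎
    where
    vanish : ∀ (θ : Composition (suc m)) f → weight θ * nestedSum (blocks θ f) 0 ≡ 0ℚ
    vanish θ@(1+ k ∷ _) f = *-zeroʳ (weight θ)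

  -- The stuffle product of m single sums. The induction on `n` covers all lengths at once, since
  -- its step uses shorter words at the same `n`.
  expansion≡∏ : ∀ n {m} (v : Fin m → A) → expansion v n ≡ ∏ (λ j → ∑< n (x (v j)))
  expansion≡∏ zero    v = expansion-0 v
  expansion≡∏ (suc n) v = expansion-suc≡ n (expansion≡∏ n) v

-- Powers of signs and of reciprocals.

infixr 8 _^⋆_

_^⋆_ : Sign → ℕ → ℚ
σ ^⋆ n = ((σ ◃ 1) ℤ.^ n) ⋆

-^⋆-suc : ∀ n → Sign.- ^⋆ suc n ≡ - (Sign.- ^⋆ n)
-^⋆-suc n = neg⋆ (-1ℤ ℤ.^ n)

+^⋆ : ∀ n → Sign.+ ^⋆ n ≡ 1ℚ
+^⋆ n = cong _⋆ (ℤ.^-zeroˡ n)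

-^⋆-+ : ∀ m n → Sign.- ^⋆ (m ℕ.+ n) ≡ Sign.- ^⋆ m * Sign.- ^⋆ n
-^⋆-+ zero    n = sym (*-identityˡ (Sign.- ^⋆ n))
-^⋆-+ (suc m) n = begin
  Sign.- ^⋆ suc (m ℕ.+ n)           ≡⟨ -^⋆-suc (m ℕ.+ n) ⟩
  - (Sign.- ^⋆ (m ℕ.+ n))           ≡⟨ cong -_ (-^⋆-+ m n) ⟩
  - (Sign.- ^⋆ m * Sign.- ^⋆ n)     ≡⟨ solve 2 (λ a b → :- (a :* b) := (:- a) :* b) refl (Sign.- ^⋆ m) (Sign.- ^⋆ n) ⟩
  - (Sign.- ^⋆ m) * Sign.- ^⋆ n     ≡⟨ cong (_* Sign.- ^⋆ n) (sym (-^⋆-suc m)) ⟩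
  Sign.- ^⋆ suc m * Sign.- ^⋆ n ∎

-^⋆-square : ∀ n → Sign.- ^⋆ n * Sign.- ^⋆ n ≡ 1ℚ
-^⋆-square zero    = refl
-^⋆-square (suc n) = begin
  Sign.- ^⋆ suc n * Sign.- ^⋆ suc n     ≡⟨ cong (λ x → x * x) (-^⋆-suc n) ⟩
  - (Sign.- ^⋆ n) * - (Sign.- ^⋆ n)     ≡⟨ solve 1 (λ a → (:- a) :* (:- a) := a :* a) refl (Sign.- ^⋆ n) ⟩
  Sign.- ^⋆ n * Sign.- ^⋆ n             ≡⟨ -^⋆-square n ⟩
  1ℚ ∎

opposite-^⋆ : ∀ σ n → Sign.opposite σ ^⋆ n ≡ Sign.- ^⋆ n * σ ^⋆ n
opposite-^⋆ Sign.+ n = trans (sym (*-identityʳ (Sign.- ^⋆ n))) (cong (Sign.- ^⋆ n *_) (sym (+^⋆ n)))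
opposite-^⋆ Sign.- n = trans (+^⋆ n) (sym (-^⋆-square n))

sign : ℕ → Sign
sign n = toSign (ℕ.parity n)

sign-suc : ∀ n → sign (suc n) ≡ Sign.opposite (sign n)
sign-suc zero          = refl
sign-suc (suc zero)    = refl
sign-suc (suc (suc n)) = sign-suc n

sign-+-^⋆ : ∀ m n k → sign (m ℕ.+ n) ^⋆ k ≡ sign m ^⋆ k * sign n ^⋆ k
sign-+-^⋆ zero    n k = sym (trans (cong (_* sign n ^⋆ k) (+^⋆ k)) (*-identityˡ _))
sign-+-^⋆ (suc m) n k = begin
  sign (suc (m ℕ.+ n)) ^⋆ k                   ≡⟨ suc-^⋆ (m ℕ.+ n) ⟩
  Sign.- ^⋆ k * sign (m ℕ.+ n) ^⋆ k           ≡⟨ cong (Sign.- ^⋆ k *_) (sign-+-^⋆ m n k) ⟩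
  Sign.- ^⋆ k * (sign m ^⋆ k * sign n ^⋆ k)   ≡⟨ sym (*-assoc (Sign.- ^⋆ k) (sign m ^⋆ k) (sign n ^⋆ k)) ⟩
  Sign.- ^⋆ k * sign m ^⋆ k * sign n ^⋆ k     ≡⟨ cong (_* sign n ^⋆ k) (sym (suc-^⋆ m)) ⟩
  sign (suc m) ^⋆ k * sign n ^⋆ k ∎
  where
  suc-^⋆ : ∀ m → sign (suc m) ^⋆ k ≡ Sign.- ^⋆ k * sign m ^⋆ k
  suc-^⋆ m = trans (cong (_^⋆ k) (sign-suc m)) (opposite-^⋆ (sign m) k)

-- Puts every summand into the form sign times power of `u k`, where exponents add.
/[1+]^-pow : ∀ z k s → z /[1+ k ]^ s ≡ z ⋆ * pow (u k) (value s)
/[1+]^-pow z k s = /-pow z k (value s) {{ℕ.m^n≢0 (suc k) (value s)}}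

value-+⁺ : ∀ r s → value (r +⁺ s) ≡ value r ℕ.+ value s
value-+⁺ (mk⁺ (suc r)) s = refl

pow-+⁺ : ∀ p r s → pow p (value (r +⁺ s)) ≡ pow p (value r) * pow p (value s)
pow-+⁺ p r s = trans (cong (pow p) (value-+⁺ r s)) (pow-+ p (value r) (value s))

-- The 1-based index j + 1 exceeds l exactly when the 0-based `j` is not below `l`.
χℕ-⊖ : ∀ j l → χℕ (suc j ℤ.⊖ l) ≡ (if j ℕ.<ᵇ l then 0 else 1)
χℕ-⊖ j       zero    = refl
χℕ-⊖ zero    (suc l) = trans (cong χℕ (ℤ.[1+m]⊖[1+n]≡m⊖n 0 l)) (χℕ-0⊖ l)
  where
  χℕ-0⊖ : ∀ l → χℕ (0 ℤ.⊖ l) ≡ 0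
  χℕ-0⊖ zero    = refl
  χℕ-0⊖ (suc l) = refl
χℕ-⊖ (suc j) (suc l) = trans (cong χℕ (ℤ.[1+m]⊖[1+n]≡m⊖n (suc j) l)) (χℕ-⊖ j l)

-- From nested harmonic sums to alternating multiple zeta values.

module _ {m} (l : ℕ) (i : Vector ℕ⁺ m) where

  -- The case distinction sits inside the summand, so that each harmonic factor is a partial sum of
  -- one letter's sequence.
  harmonicTerm : Fin m → ℕ → ℚ
  harmonicTerm j k = if toℕ j ℕ.<ᵇ l then ℤ.+ 1 /[1+ k ]^ i j else (-1ℤ ℤ.^ k) /[1+ k ]^ i j

  harmonicFactor≡∑< : ∀ n j → harmonicFactor l i n j ≡ ∑< n (harmonicTerm j)
  harmonicFactor≡∑< n j with toℕ j ℕ.<ᵇ l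
  ... | true  = refl
  ... | false = refl

  open Expansion harmonicTerm

  χ : Fin m → ℕ
  χ j = χℕ (ℤ.+ suc (toℕ j) ℤ.- ℤ.+ l)

  χ≡ : ∀ j → χ j ≡ (if toℕ j ℕ.<ᵇ l then 0 else 1)
  χ≡ j = trans (cong χℕ (ℤ.m-n≡m⊖n (suc (toℕ j)) l)) (χℕ-⊖ (toℕ j) l)

  -- H̄ carries the sign (-1)^{n-1} where ζ has σ^n, which costs the factor (-1)^χ.
  harmonicTerm≡ : ∀ j k → harmonicTerm j k ≡
    Sign.- ^⋆ χ j * (sign (χ j) ^⋆ suc k * pow (u k) (value (i j)))
  harmonicTerm≡ j k rewrite χ≡ j with toℕ j ℕ.<ᵇ l
  ... | true  = trans (/[1+]^-pow (ℤ.+ 1) k (i j))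
    (trans (cong (_* pow (u k) (value (i j))) (sym (+^⋆ (suc k)))) (sym (*-identityˡ _)))
  ... | false = trans (/[1+]^-pow (-1ℤ ℤ.^ k) k (i j))
    (trans (solve 2 (λ x y → x :* y := con (- 1ℚ) :* ((:- x) :* y)) refl (Sign.- ^⋆ k) (pow (u k) (value (i j))))
           (cong (λ x → - 1ℚ * (x * pow (u k) (value (i j)))) (sym (-^⋆-suc k))))

  entryTerm : Entry → ℕ → ℚ
  entryTerm (s , σ) k = ((σ ◃ 1) ℤ.^ suc k) /[1+ k ]^ s

  -- All three factors are multiplicative along a block, because `λ#` and `blockSum` are additive.
  blockTerm-pow : ∀ j js k → let b = j ∷ js in blockTerm b k ≡
    Sign.- ^⋆ λ# l b * (sign (λ# l b) ^⋆ suc k * pow (u k) (value (blockSum i b)))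
  blockTerm-pow j []        k = trans (harmonicTerm≡ j k)
    (cong (λ n → Sign.- ^⋆ n * (sign n ^⋆ suc k * pow (u k) (value (i j)))) (sym (ℕ.+-identityʳ (χ j))))
  blockTerm-pow j (j′ ∷ js) k = begin
    harmonicTerm j k * blockTerm b k
      ≡⟨ cong₂ _*_ (harmonicTerm≡ j k) (blockTerm-pow j′ js k) ⟩
    (x * (y * z)) * (x′ * (y′ * z′))
      ≡⟨ solve 6 (λ x y z x′ y′ z′ → (x :* (y :* z)) :* (x′ :* (y′ :* z′)) := (x :* x′) :* ((y :* y′) :* (z :* z′)))
           refl x y z x′ y′ z′ ⟩
    (x * x′) * ((y * y′) * (z * z′))
      ≡⟨ sym (cong₂ _*_ (-^⋆-+ (χ j) (λ# l b))
           (cong₂ _*_ (sign-+-^⋆ (χ j) (λ# l b) (suc k)) (pow-+⁺ (u k) (i j) (blockSum i b)))) ⟩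
    Sign.- ^⋆ λ# l b⁺ * (sign (λ# l b⁺) ^⋆ suc k * pow (u k) (value (blockSum i b⁺))) ∎
    where
    b b⁺ : List⁺ (Fin m)
    b  = j′ ∷ js
    b⁺ = j ∷ j′ ∷ js
    x  = Sign.- ^⋆ χ j
    y  = sign (χ j) ^⋆ suc k
    z  = pow (u k) (value (i j))
    x′ = Sign.- ^⋆ λ# l b
    y′ = sign (λ# l b) ^⋆ suc k
    z′ = pow (u k) (value (blockSum i b))

  blockTerm≡ : ∀ b k → blockTerm b k ≡ Sign.- ^⋆ λ# l b * entryTerm (T̃ l i b) k
  blockTerm≡ b@(j ∷ js) k = trans (blockTerm-pow j js k)
    (cong (Sign.- ^⋆ λ# l b *_) (sym (/[1+]^-pow ((sign (λ# l b) ◃ 1) ℤ.^ suc k) k (blockSum i b))))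

  ∑λ# : List (List⁺ (Fin m)) → ℕ
  ∑λ# bs = sum (List.map (λ# l) bs)

  -- The constant sign of each block leaves its sum, and these signs multiply to the power of -1
  -- with exponent λ₁ + ⋯ + λ_p.
  nestedSum≡ζ : ∀ bs n → nestedSum bs n ≡ Sign.- ^⋆ ∑λ# bs * ζ-partial (List.map (T̃ l i) bs) n
  nestedSum≡ζ []       n = refl
  nestedSum≡ζ (b ∷ bs) n = begin
    ∑< n (λ k → blockTerm b k * nestedSum bs k)
      ≡⟨ ∑<-cong (λ k → trans (cong₂ _*_ (blockTerm≡ b k) (nestedSum≡ζ bs k))
           (solve 4 (λ x e y z → (x :* e) :* (y :* z) := (x :* y) :* (e :* z)) refl
             (Sign.- ^⋆ λ# l b) (entryTerm (T̃ l i b) k) (Sign.- ^⋆ ∑λ# bs) (ζ-partial w k))) n ⟩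
    ∑< n (λ k → (Sign.- ^⋆ λ# l b * Sign.- ^⋆ ∑λ# bs) * (entryTerm (T̃ l i b) k * ζ-partial w k))
      ≡⟨ ∑<-*ˡ (Sign.- ^⋆ λ# l b * Sign.- ^⋆ ∑λ# bs) (λ k → entryTerm (T̃ l i b) k * ζ-partial w k) n ⟩
    (Sign.- ^⋆ λ# l b * Sign.- ^⋆ ∑λ# bs) * ζ-partial (T̃ l i b ∷ w) n
      ≡⟨ cong (_* ζ-partial (T̃ l i b ∷ w) n) (sym (-^⋆-+ (λ# l b) (∑λ# bs))) ⟩
    Sign.- ^⋆ ∑λ# (b ∷ bs) * ζ-partial (T̃ l i b ∷ w) n ∎
    where w = List.map (T̃ l i) bs

  coefficient≡ : ∀ (θ : Composition m) bs → coefficient l θ bs ≡ - (Sign.- ^⋆ ∑λ# bs) * weight θ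
  coefficient≡ θ bs = begin
    coefficient l θ bs
      ≡⟨ /-cong {{∏!≢0 θ}} {{1*∏!≢0}} (sym (ℤ.*-identityʳ z)) (sym (ℕ.*-identityˡ (∏! θ))) ⟩
    ((z ℤ.* ℤ.+ 1) / (1 ℕ.* ∏! θ)) {{1*∏!≢0}}
      ≡⟨ /-homo z (ℤ.+ 1) 1 (∏! θ) {{_}} {{∏!≢0 θ}} {{1*∏!≢0}} ⟩
    z ⋆ * weight θ
      ≡⟨ cong (_* weight θ) (trans (cong (Sign.- ^⋆_) (ℕ.+-comm (∑λ# bs) 1)) (-^⋆-suc (∑λ# bs))) ⟩
    - (Sign.- ^⋆ ∑λ# bs) * weight θ ∎
    where
    z = -1ℤ ℤ.^ (∑λ# bs ℕ.+ 1)
    1*∏!≢0 : NonZero (1 ℕ.* ∏! θ)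
    1*∏!≢0 = ℕ.m*n≢0 1 (∏! θ) {{_}} {{∏!≢0 θ}}

  -- The outer alternating sum and its two zeta values.

  module _ (q : ℕ⁺) where

    altTerm : ℕ → ℚ
    altTerm k = (-1ℤ ℤ.^ k) /[1+ k ]^ q

    -- S carries (-1)^{n-1} and ζ carries (-1)^n; this accounts for the + 1 in the exponent of
    -- `coefficient`.
    entryTerm-q̄ : ∀ k → entryTerm (q , Sign.-) k ≡ - altTerm k
    entryTerm-q̄ k = begin
      (-1ℤ ℤ.^ suc k) /[1+ k ]^ q              ≡⟨ /[1+]^-pow (-1ℤ ℤ.^ suc k) k q ⟩
      Sign.- ^⋆ suc k * pow (u k) (value q)    ≡⟨ cong (_* pow (u k) (value q)) (-^⋆-suc k) ⟩
      - (Sign.- ^⋆ k) * pow (u k) (value q)    ≡⟨ solve 2 (λ x y → (:- x) :* y := :- (x :* y)) refl (Sign.- ^⋆ k) (pow (u k) (value q)) ⟩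
      - (Sign.- ^⋆ k * pow (u k) (value q))    ≡⟨ cong -_ (sym (/[1+]^-pow (-1ℤ ℤ.^ k) k q)) ⟩
      - altTerm k ∎

    -- When n₁ = n the outer factor merges with the first block: exponents add, and the extra (-1)^n
    -- reverses the sign of the entry.
    entryTerm-Ť : ∀ b k → entryTerm (Ť l i q b) k ≡ - altTerm k * entryTerm (T̃ l i b) k
    entryTerm-Ť b k = begin
      entryTerm (Ť l i q b) k
        ≡⟨ /[1+]^-pow ((Sign.opposite σ ◃ 1) ℤ.^ suc k) k (q +⁺ s) ⟩
      Sign.opposite σ ^⋆ suc k * pow (u k) (value (q +⁺ s))
        ≡⟨ cong₂ _*_ (opposite-^⋆ σ (suc k)) (pow-+⁺ (u k) q s) ⟩
      (Sign.- ^⋆ suc k * σ ^⋆ suc k) * (pow (u k) (value q) * pow (u k) (value s))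
        ≡⟨ solve 4 (λ a b c d → (a :* b) :* (c :* d) := (a :* c) :* (b :* d)) refl
             (Sign.- ^⋆ suc k) (σ ^⋆ suc k) (pow (u k) (value q)) (pow (u k) (value s)) ⟩
      (Sign.- ^⋆ suc k * pow (u k) (value q)) * (σ ^⋆ suc k * pow (u k) (value s))
        ≡⟨ sym (cong₂ _*_ (/[1+]^-pow (-1ℤ ℤ.^ suc k) k q) (/[1+]^-pow ((σ ◃ 1) ℤ.^ suc k) k s)) ⟩
      entryTerm (q , Sign.-) k * entryTerm (T̃ l i b) k
        ≡⟨ cong (_* entryTerm (T̃ l i b) k) (entryTerm-q̄ k) ⟩
      - altTerm k * entryTerm (T̃ l i b) k ∎
      where
      σ = sign (λ# l b)
      s = blockSum i b

    ∑<-nestedSum : ∀ (θ : Composition m) b bs N →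
      ∑< N (λ k → altTerm k * (weight θ * nestedSum (b ∷ bs) (suc k))) ≡
      coefficient l θ (b ∷ bs) *
        (ζ-partial (List⁺.toList (q̄T̃ l i q (b ∷ bs))) N + ζ-partial (List⁺.toList (ŤT̃ l i q (b ∷ bs))) N)
    ∑<-nestedSum θ b bs N = begin
      ∑< N (λ k → altTerm k * (weight θ * nestedSum (b ∷ bs) (suc k)))
        ≡⟨ ∑<-cong term N ⟩
      ∑< N (λ k → c * (p k + r k))
        ≡⟨ ∑<-*ˡ c (λ k → p k + r k) N ⟩
      c * ∑< N (λ k → p k + r k)
        ≡⟨ cong (c *_) (∑<-+ p r N) ⟩
      c * (∑< N p + ∑< N r) ∎
      where
      c = coefficient l θ (b ∷ bs)
      w = List.map (T̃ l i) bs
      x = Sign.- ^⋆ λ# l b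
      y = Sign.- ^⋆ ∑λ# bs
      p r : ℕ → ℚ
      p k = entryTerm (q , Sign.-) k * ζ-partial (T̃ l i b ∷ w) k
      r k = entryTerm (Ť l i q b) k * ζ-partial w k
      term : ∀ k → altTerm k * (weight θ * nestedSum (b ∷ bs) (suc k)) ≡ c * (p k + r k)
      term k = begin
        -- With n = k + 1, the first summand collects n₁ < n and the second is the term n₁ = n.
        a * (weight θ * (nestedSum (b ∷ bs) k + blockTerm b k * nestedSum bs k))
          ≡⟨ cong₂ (λ Y Z → a * (weight θ * (Y + Z)))
               (trans (nestedSum≡ζ (b ∷ bs) k) (cong (_* ζ₁) (-^⋆-+ (λ# l b) (∑λ# bs))))
               (cong₂ _*_ (blockTerm≡ b k) (nestedSum≡ζ bs k)) ⟩
        a * (weight θ * ((x * y) * ζ₁ + (x * e) * (y * ζ₂)))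
          -- Two minus signs are inserted, one for the coefficient and one for the outer factor.
          ≡⟨ solve 7 (λ a w x y e ζ₁ ζ₂ → a :* (w :* ((x :* y) :* ζ₁ :+ (x :* e) :* (y :* ζ₂))) :=
               ((:- (x :* y)) :* w) :* ((:- a) :* ζ₁ :+ ((:- a) :* e) :* ζ₂)) refl a (weight θ) x y e ζ₁ ζ₂ ⟩
        (- (x * y) * weight θ) * (- a * ζ₁ + (- a * e) * ζ₂)
          ≡⟨ sym (cong₂ _*_
               (trans (coefficient≡ θ (b ∷ bs)) (cong (λ z → - z * weight θ) (-^⋆-+ (λ# l b) (∑λ# bs))))
               (cong₂ _+_ (cong (_* ζ₁) (entryTerm-q̄ k)) (cong (_* ζ₂) (entryTerm-Ť b k)))) ⟩
        c * (p k + r k) ∎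
        where
        a  = altTerm k
        e  = entryTerm (T̃ l i b) k
        ζ₁ = ζ-partial (T̃ l i b ∷ w) k
        ζ₂ = ζ-partial w k

-- From partial sums to real numbers.

seq-∑ : ∀ xs (f : A → ℝ) n → ℝ.seq (∑ xs f) n ≡ ∑ₗ xs (λ x → ℝ.seq (f x) n)
seq-∑ []       f n = refl
seq-∑ (x ∷ xs) f n = cong (ℝ.seq (f x) n +_) (seq-∑ xs f n)

seq-∑∑ : ∀ xs ys (f : A → B → ℝ) n →
         ℝ.seq (∑ xs λ a → ∑ ys λ b → f a b) n ≡ ∑ₗ xs (λ a → ∑ₗ ys (λ b → ℝ.seq (f a b) n))
seq-∑∑ xs ys f n = trans (seq-∑ xs (λ a → ∑ ys (f a)) n) (∑ₗ-cong xs λ a → seq-∑ ys (f a) n)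

∣p-q∣<ε : ∀ {p q ε} → p ≡ q → 0ℚ ℚ.< ε → ∣ p - q ∣ ℚ.< ε
∣p-q∣<ε {p} {ε = ε} refl 0<ε = subst (λ r → ∣ r ∣ ℚ.< ε) (sym (+-inverseʳ p)) 0<ε

-- The difference of the two sequences is identically 0, so the threshold 0 serves for every ε.
≈-∑∑ : ∀ (x : ℝ) xs ys (f : A → B → ℝ) →
       (∀ n → ℝ.seq x n ≡ ∑ₗ xs (λ a → ∑ₗ ys (λ b → ℝ.seq (f a b) n))) →
       x ≈ ∑ xs (λ a → ∑ ys (λ b → f a b))
≈-∑∑ x xs ys f x≡ ε 0<ε = 0 , λ n _ → ∣p-q∣<ε (trans (x≡ n) (sym (seq-∑∑ xs ys f n))) 0<ε

-- Splitting `θ` exposes the first block, on which `blocks` and `blocks⁺` agree; the empty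
-- composition is excluded because `m` is nonzero.
∑<-summand : ∀ {m} .{{_ : NonZero m}} l (i : Vector ℕ⁺ m) q (θ : Composition m) (f : Fin m → Fin m) N →
  ∑< N (λ k → altTerm l i q k * (weight θ * Expansion.nestedSum (harmonicTerm l i) (blocks θ f) (suc k))) ≡
  coefficient l θ (blocks θ f) *
    (ζ-partial (List⁺.toList (q̄T̃ l i q (blocks⁺ θ f))) N + ζ-partial (List⁺.toList (ŤT̃ l i q (blocks⁺ θ f))) N)
∑<-summand {{()}} l i q []
∑<-summand l i q θ@(1+ k ∷ θ′) f = ∑<-nestedSum l i q θ (firstBlock k f) (blocks θ′ (λ j → f (suc k ↑ʳ j)))

module _ {m} .{{_ : NonZero m}} (l : ℕ) (i : Vector ℕ⁺ m) (q : ℕ⁺) where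

  private
    θs = compositions m
    ρs = permutations m
    x  = harmonicTerm l i

  open Expansion x

  private
    F : Composition m → Permutation′ m → ℕ → ℚ
    F θ ρ k = weight θ * nestedSum (blocks θ (ρ ⟨$⟩ʳ_)) (suc k)

  -- The letters are the indices themselves, hence the word `id`; H_n includes its n-th term, hence
  -- `suc k`.
  S-partial≡∑<-expansion : ∀ N → S-partial l i q N ≡ ∑< N (λ k → altTerm l i q k * expansion id (suc k))
  S-partial≡∑<-expansion = ∑<-cong λ k → cong (altTerm l i q k *_)
    (trans (∏-cong {f = harmonicFactor l i (suc k)} (harmonicFactor≡∑< l i (suc k))) (sym (expansion≡∏ (suc k) id)))

  altTerm*expansion : ∀ k → altTerm l i q k * expansion id (suc k) ≡
                            ∑ₗ θs (λ θ → ∑ₗ ρs (λ ρ → altTerm l i q k * F θ ρ k))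
  altTerm*expansion k = sym (trans
    (∑ₗ-cong θs λ θ → ∑ₗ-*ˡ (altTerm l i q k) (λ ρ → F θ ρ k) ρs)
    (∑ₗ-*ˡ (altTerm l i q k) (λ θ → ∑ₗ ρs λ ρ → F θ ρ k) θs))

  ∑<-altTerm*expansion : ∀ N → ∑< N (λ k → altTerm l i q k * expansion id (suc k)) ≡
                               ∑ₗ θs (λ θ → ∑ₗ ρs (λ ρ → ∑< N (λ k → altTerm l i q k * F θ ρ k)))
  ∑<-altTerm*expansion N = trans (∑<-cong altTerm*expansion N)
    (trans (∑<-∑ₗ (λ k θ → ∑ₗ ρs λ ρ → altTerm l i q k * F θ ρ k) θs N)
           (∑ₗ-cong θs λ θ → ∑<-∑ₗ (λ k ρ → altTerm l i q k * F θ ρ k) ρs N))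

  S-partial≡ : ∀ N → S-partial l i q N ≡
    ∑ₗ θs (λ θ → ∑ₗ ρs (λ ρ → coefficient l θ (blocks θ (ρ ⟨$⟩ʳ_)) *
      (ζ-partial (List⁺.toList (q̄T̃ l i q (blocks⁺ θ (ρ ⟨$⟩ʳ_)))) N
       + ζ-partial (List⁺.toList (ŤT̃ l i q (blocks⁺ θ (ρ ⟨$⟩ʳ_)))) N)))
  S-partial≡ N = trans (S-partial≡∑<-expansion N) (trans (∑<-altTerm*expansion N)
    (∑ₗ-cong θs λ θ → ∑ₗ-cong ρs λ ρ → ∑<-summand l i q θ (ρ ⟨$⟩ʳ_) N))

theorem4p3 : (m l : ℕ) → .{{_ : NonZero m}} → l ≤ m →
    (i : Vector ℕ⁺ m) →
    (∀ (j k : Fin m) → toℕ k < l → j Fin.≤ k → value (i j) ≤ value (i k)) →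
    (∀ (j k : Fin m) → l ≤ toℕ j → j Fin.≤ k → value (i j) ≤ value (i k)) →
    (q : ℕ⁺) →
    S l i q ≈
    ∑[ θ ∈ compositions m ]
    ∑[ ρ ∈ permutations m ]
    coefficient l θ (blocks θ (ρ ⟨$⟩ʳ_)) ·
    (ζ (q̄T̃ l i q (blocks⁺ θ (ρ ⟨$⟩ʳ_))) (q̄T̃-admissible l i q (blocks⁺ θ (ρ ⟨$⟩ʳ_)))
    ⊕ ζ (ŤT̃ l i q (blocks⁺ θ (ρ ⟨$⟩ʳ_))) (ŤT̃-admissible l i q (blocks⁺ θ (ρ ⟨$⟩ʳ_))))
-- The instance is explicit and ρ is not in a section so that the types match syntactically;
-- otherwise the conversion check unfolds the convergence proofs and does not return.
theorem4p3 m l {{m≢0}} _ i _ _ q = ≈-∑∑ (S l i q) (compositions m) (permutations m)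
  (λ θ ρ → coefficient l θ (blocks θ (_⟨$⟩ʳ_ ρ)) ·
    (ζ (q̄T̃ l i q (blocks⁺ {{m≢0}} θ (_⟨$⟩ʳ_ ρ))) (q̄T̃-admissible l i q (blocks⁺ {{m≢0}} θ (_⟨$⟩ʳ_ ρ)))
     ⊕ ζ (ŤT̃ l i q (blocks⁺ {{m≢0}} θ (_⟨$⟩ʳ_ ρ))) (ŤT̃-admissible l i q (blocks⁺ {{m≢0}} θ (_⟨$⟩ʳ_ ρ)))))
  (S-partial≡ l i q)
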